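{- Let $Q$ be an $(n,q)$-cactus with $q\ge 2$. The following are equivalent: (i) $\overrightarrow{rvc}(Q)=n-2q+2$; (ii) $\overrightarrow{trc}(Q)=2n-3q+3$; (iii) $d(u,v)\ge 3$ for all distinct $u,v\in K_Q$.
   Context: A cactus is a strongly connected oriented graph (finite, no loops, no multiple arcs, no pair of opposite arcs) in which every arc belongs to exactly one directed cycle; its blocks (maximal subdigraphs without a cut-vertex) are directed cycles. An $(n,q)$-cactus has $n$ vertices and $q$ blocks. $K_Q$ is the set of cut-vertices of $Q$, and $d(u,v)$ is the length of the shortest directed $u$–$v$ path. $\overrightarrow{rvc}(D)$ is the minimum number of colours in a vertex-colouring such that every ordered pair $(x,y)$ is joined by a directed path whose internal vertices have distinct colours. $\overrightarrow{trc}(D)$ is the minimum number of colours in a total-colouring (of vertices and arcs) such that every ordered pair is joined by a directed path whose arcs and internal vertices all receive pairwise distinct colours. -}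

module Defs where

open import Data.Nat using (ℕ; _≤_; _+_)
open import Data.Fin using (Fin)
open import Data.Bool using (Bool; true; false)
open import Data.List using (List; []; _∷_; _++_; map; length)
open import Data.List.Relation.Unary.All using (All)
open import Data.List.Relation.Unary.Unique.Propositional using (Unique)
open import Data.List.Membership.Propositional using (_∈_)
open import Data.Product using (Σ; ∃; _×_; _,_; proj₁; proj₂)
open import Data.Sum using (_⊎_)
open import Data.Unit using (⊤)
open import Relation.Nullary using (¬_)
open import Relation.Binary.PropositionalEquality using (_≡_; _≢_)

record Digraph (n : ℕ) : Set where
  field
    adj : Fin n → Fin n → Bool

open Digraph public

Arc : ∀ {n} → Digraph n → Fin n → Fin n → Set
Arc D u v = adj D u v ≡ true

pairs : ∀ {A : Set} → List A → List (A × A)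
pairs [] = []
pairs (x ∷ []) = []
pairs (x ∷ y ∷ rest) = (x , y) ∷ pairs (y ∷ rest)

IsWalk : ∀ {n} → Digraph n → List (Fin n) → Set
IsWalk D [] = ⊤
IsWalk D (x ∷ []) = ⊤
IsWalk D (x ∷ y ∷ rest) = Arc D x y × IsWalk D (y ∷ rest)

seq : ∀ {n} → Fin n → List (Fin n) → Fin n → List (Fin n)
seq x mid y = x ∷ mid ++ y ∷ []

IsPath : ∀ {n} → Digraph n → Fin n → List (Fin n) → Fin n → Set
IsPath D x mid y = IsWalk D (seq x mid y) × Unique (seq x mid y)

IsOriented : ∀ {n} → Digraph n → Set
IsOriented D = (∀ v → adj D v v ≡ false) × (∀ u v → Arc D u v → adj D v u ≡ false)

StronglyConnected : ∀ {n} → Digraph n → Set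
StronglyConnected {n} D = ∀ (x y : Fin n) → x ≢ y → ∃ λ mid → IsPath D x mid y

IsDirCycle : ∀ {n} → Digraph n → (Fin n → Fin n → Bool) → Set
IsDirCycle {n} D C =
  Σ (Fin n) λ v0 → Σ (List (Fin n)) λ rest →
    rest ≢ [] × Unique (v0 ∷ rest) × IsWalk D (v0 ∷ rest ++ v0 ∷ []) ×
    (∀ a b → (C a b ≡ true → (a , b) ∈ pairs (v0 ∷ rest ++ v0 ∷ [])) ×
             ((a , b) ∈ pairs (v0 ∷ rest ++ v0 ∷ []) → C a b ≡ true))

SameArcSet : ∀ {n} → (Fin n → Fin n → Bool) → (Fin n → Fin n → Bool) → Set
SameArcSet {n} C C' = ∀ (a b : Fin n) → C a b ≡ C' a b

IsCactus : ∀ {n} → Digraph n → Set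
IsCactus {n} D =
  IsOriented D × StronglyConnected D ×
  (∀ u v → Arc D u v →
     Σ (Fin n → Fin n → Bool) λ C → IsDirCycle D C × C u v ≡ true ×
       (∀ C' → IsDirCycle D C' → C' u v ≡ true → SameArcSet C' C))

-- D has exactly q blocks. In a cactus the blocks are exactly its directed cycles,
-- so this says: D has exactly q distinct directed cycles.
NumBlocks : ∀ {n} → Digraph n → ℕ → Set
NumBlocks {n} D q =
  Σ (Fin q → Fin n → Fin n → Bool) λ f →
    (∀ i → IsDirCycle D (f i)) ×
    (∀ i j → SameArcSet (f i) (f j) → i ≡ j) ×
    (∀ C → IsDirCycle D C → ∃ λ i → SameArcSet C (f i))

IsUWalk : ∀ {n} → Digraph n → List (Fin n) → Set
IsUWalk D [] = ⊤
IsUWalk D (x ∷ []) = ⊤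
IsUWalk D (x ∷ y ∷ rest) = (Arc D x y ⊎ Arc D y x) × IsUWalk D (y ∷ rest)

IsCutVertex : ∀ {n} → Digraph n → Fin n → Set
IsCutVertex {n} D v =
  Σ (Fin n) λ x → Σ (Fin n) λ y → x ≢ v × y ≢ v ×
    ¬ (∃ λ mid → IsUWalk D (seq x mid y) × All (_≢ v) (seq x mid y))

Dist : ∀ {n} → Digraph n → Fin n → Fin n → ℕ → Set
Dist D u v k =
  (∃ λ mid → IsPath D u mid v × length mid + 1 ≡ k) ×
  (∀ mid → IsPath D u mid v → k ≤ length mid + 1)

HasRVColouring : ∀ {n} → Digraph n → ℕ → Set
HasRVColouring {n} D k =
  Σ (Fin n → Fin k) λ c →
    ∀ (x y : Fin n) → x ≢ y → ∃ λ mid → IsPath D x mid y × Unique (map c mid)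

RVC≡ : ∀ {n} → Digraph n → ℕ → Set
RVC≡ D k = HasRVColouring D k × (∀ m → HasRVColouring D m → k ≤ m)

HasTRColouring : ∀ {n} → Digraph n → ℕ → Set
HasTRColouring {n} D k =
  Σ (Fin n → Fin k) λ cv → Σ (Fin n → Fin n → Fin k) λ ca →
    ∀ (x y : Fin n) → x ≢ y → ∃ λ mid → IsPath D x mid y ×
      Unique (map cv mid ++ map (λ p → ca (proj₁ p) (proj₂ p)) (pairs (seq x mid y)))

TRC≡ : ∀ {n} → Digraph n → ℕ → Set
TRC≡ D k = HasTRColouring D k × (∀ m → HasTRColouring D m → k ≤ m)

{-# OPTIONS --safe #-}
-- In a cactus two walks that leave a through different arcs and reach the same vertex without
-- returning to a would close up to two cycles sharing an arc; hence directed paths are unique.  Fix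
-- a cut-vertex r, and call the vertex of a cycle that is nearest to r the gate of the cycle.
--
-- Lower bounds: two elements (vertices or arcs) clash if some path uses both, so that they need
-- different colours.  The vertices clash pairwise once the successor and the predecessor of the gate
-- are discarded on every cycle, and one successor o and one predecessor i of r, on different cycles,
-- can be kept.  They also clash with i → r and the last arcs of the paths from r to the vertices,
-- and these with each other, once the arcs gate → successor other than r → o are discarded.  If a
-- cut-vertex v is at distance at most 2 from r, then one further predecessor j of v can be kept, with
-- j → v in place of the last arc of the path from r to v, so that one more colour is needed.
--
-- Upper bounds: if the cut-vertices are at pairwise distance at least 3, then all successors of a
-- cut-vertex w can share a colour, and so can its predecessors, the arcs leaving w, and the arcs
-- entering w, because a path cannot use two of them.
module Submission where

open import Defs
import Data.Bool as Bool
open import Data.Bool using (true)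
open import Data.Empty using (⊥; ⊥-elim)
open import Data.Fin using (Fin; zero; suc; _≟_; inject≤; join)
open import Data.Fin.Properties using (injective⇒≤; inject≤-injective; +↔⊎; any?)
open import Data.List using (List; []; _∷_; _++_; map; filter; allFin; length; lookup)
import Data.List.Membership.DecPropositional as DecMembership
open import Data.List.Membership.Propositional using (_∈_)
open import Data.List.Membership.Propositional.Properties
  using (∈-++⁺ˡ; ∈-++⁺ʳ; ∈-++⁻; ∈-map⁺; ∈-map⁻; ∈-filter⁺; ∈-filter⁻; ∈-allFin; ∈-lookup)
open import Data.List.Properties using (map-++; map-∘)
open import Data.List.Relation.Unary.All as All using (All; []; _∷_)
import Data.List.Relation.Unary.All.Properties as All
open import Data.List.Relation.Unary.AllPairs using ([]; _∷_)
open import Data.List.Relation.Unary.Any as Any using (here; there; index)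
open import Data.List.Relation.Unary.Any.Properties using (lookup-index)
open import Data.List.Relation.Unary.Unique.Propositional using (Unique)
import Data.List.Relation.Unary.Unique.Propositional.Properties as Unique
open import Data.Nat using (ℕ; _+_; _*_; _∸_; _≤_; z≤n; s≤s; _≤?_)
import Data.Nat.Properties as ℕ
open import Data.Nat.Solver using (module +-*-Solver)
open import Data.Product using (∃; ∃₂; _×_; _,_; proj₁; proj₂)
open import Data.Product.Properties using (≡-dec)
open import Data.Sum using (_⊎_; inj₁; inj₂; [_,_]′; swap)
open import Data.Sum.Function.Propositional using (_⊎-↔_)
open import Data.Unit using (⊤; tt)
open import Function using (_∘_; flip; id)
open import Function.Bundles using (_⇔_; mk⇔; _↔_; Inverse; Injection)
open import Function.Construct.Composition using (_↔-∘_)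
open import Function.Construct.Identity using (↔-id)
open import Function.Definitions using (Injective)
open import Function.Properties.Inverse using (↔-sym; ↔⇒↣)
open import Relation.Nullary using (¬_; Dec; yes; no; does; contradiction)
open import Relation.Nullary.Decidable using (_×-dec_; _→-dec_; ¬?)
open import Relation.Binary.PropositionalEquality
  using (_≡_; _≢_; refl; sym; trans; cong; cong₂; subst)

-- Everything rests on one relation: `Sep a x y`, no walk from x to y misses a. As directed paths
-- are unique, it says that a lies on the path, so walks can be glued and cut freely and no list of
-- vertices has to be followed. The second device treats vertices and arcs alike: an element is
-- known by the arc α → β through which a path enters it and the arc γ → δ through which the path
-- leaves it. A clash is then a path that begins with the entering arc of one element and ends with
-- the leaving arc of the other, so that one case analysis covers all kinds of pairs. Arcs are
-- counted by their heads: in the basic clique a head b ≠ r stands for the last arc of the path from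
-- r to b, and r stands for i → r. Discarding one head per cycle but keeping o leaves n - q + 1
-- arcs, which with n - 2q + 2 vertices gives 2n - 3q + 3. The axioms are symmetric under reversal
-- of all arcs, so many lemmas are read off the reversed cactus.

private variable
  n q : ℕ

-- Walks with a condition on their vertices, and loop erasure

data Walk {V : Set} (E : V → V → Set) (P : V → Set) : V → V → Set where
  stop : ∀ {x} → P x → Walk E P x x
  step : ∀ {x y z} → P x → E x y → Walk E P y z → Walk E P x z

module _ {V : Set} {E : V → V → Set} where

  walk-source : ∀ {P : V → Set} {x y} → Walk E P x y → P x
  walk-source (stop p) = p
  walk-source (step p _ _) = p

  walk-target : ∀ {P : V → Set} {x y} → Walk E P x y → P y
  walk-target (stop p) = p
  walk-target (step _ _ w) = walk-target w

  walk-++ : ∀ {P : V → Set} {x y z} → Walk E P x y → Walk E P y z → Walk E P x z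
  walk-++ (stop _) w = w
  walk-++ (step p e v) w = step p e (walk-++ v w)

  walk-∷ʳ : ∀ {P : V → Set} {x y z} → Walk E P x y → E y z → P z → Walk E P x z
  walk-∷ʳ w e p = walk-++ w (step (walk-target w) e (stop p))

  walk-map : ∀ {F : V → V → Set} {P Q : V → Set} →
             (∀ {a b} → E a b → F a b) → (∀ {a} → P a → Q a) →
             ∀ {x y} → Walk E P x y → Walk F Q x y
  walk-map f g (stop p) = stop (g p)
  walk-map f g (step p e w) = step (g p) (f e) (walk-map f g w)

walk-reverse : ∀ {V : Set} {E : V → V → Set} {P : V → Set} {x y} →
               Walk E P x y → Walk (flip E) P y x
walk-reverse (stop p) = stop p
walk-reverse (step p e w) = walk-∷ʳ (walk-reverse w) e p

Avoiding : (Fin n → Fin n → Set) → Fin n → Fin n → Fin n → Set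
Avoiding E a = Walk E (_≢ a)

module _ {E : Fin n → Fin n → Set} {P : Fin n → Set} where

  -- Cutting at the last visit to the start leaves a remainder that avoids it, which is the form of
  -- walk that `out-unique` consumes.
  last-exit : ∀ {x z} → Walk E P x z →
              x ≡ z ⊎ ∃ λ c → E x c × Walk E (λ v → P v × v ≢ x) c z
  last-exit {x} w with go w
    where
    go : ∀ {y z} → Walk E P y z → Walk E (λ v → P v × v ≢ x) y z ⊎
         (x ≡ z ⊎ ∃ λ c → E x c × Walk E (λ v → P v × v ≢ x) c z)
    go (stop {y} p) with y ≟ x
    ... | yes y≡x = inj₂ (inj₁ (sym y≡x))
    ... | no y≢x = inj₁ (stop (p , y≢x))
    go (step {y} p e w) with go w
    ... | inj₂ found = inj₂ found
    ... | inj₁ w′ with y ≟ x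
    ...   | yes refl = inj₂ (inj₂ (_ , e , w′))
    ...   | no y≢x = inj₁ (step (p , y≢x) e w′)
  ... | inj₁ w′ = contradiction refl (proj₂ (walk-source w′))
  ... | inj₂ found = found

  visit : ∀ y {x z} → Walk E P x z → (Walk E P x y × Walk E P y z) ⊎ Avoiding E y x z
  visit y (stop {x} p) with x ≟ y
  ... | yes refl = inj₁ (stop p , stop p)
  ... | no x≢y = inj₂ (stop x≢y)
  visit y (step {x} p e w) with x ≟ y
  ... | yes refl = inj₁ (stop p , step p e w)
  ... | no x≢y with visit y w
  ...   | inj₁ (w₁ , w₂) = inj₁ (step p e w₁ , w₂)
  ...   | inj₂ w′ = inj₂ (step x≢y e w′)

  first-of-two : ∀ {a b x} → a ≢ b → Walk E P x a → Avoiding E a x b ⊎ Avoiding E b x a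
  first-of-two a≢b (stop p) = inj₂ (stop a≢b)
  first-of-two {a} {b} a≢b (step {x} p e w) with x ≟ a | x ≟ b
  ... | yes refl | _ = inj₂ (stop a≢b)
  ... | no x≢a | yes refl = inj₁ (stop x≢a)
  ... | no x≢a | no x≢b with first-of-two a≢b w
  ...   | inj₁ w′ = inj₁ (step x≢a e w′)
  ...   | inj₂ w′ = inj₂ (step x≢b e w′)

  first-hit : ∀ {On : Fin n → Set} → (∀ v → Dec (On v)) → ∀ {x z} → Walk E P x z → On z →
              ∃ λ w → On w × (x ≡ w ⊎ ∃ λ t → E t w × Walk E (λ v → ¬ On v) x t)
  first-hit on? (stop {x} p) onz = x , onz , inj₁ refl
  first-hit on? (step {x} p e w) onz with on? x
  ... | yes onx = x , onx , inj₁ refl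
  ... | no offx with first-hit on? w onz
  ...   | y , ony , inj₁ refl = y , ony , inj₂ (x , e , stop offx)
  ...   | y , ony , inj₂ (t , f , w′) = y , ony , inj₂ (t , f , step offx e w′)

first-arrival : ∀ {E : Fin n → Fin n → Set} {P : Fin n → Set} {x z} → Walk E P x z →
                x ≡ z ⊎ ∃ λ t → E t z × Walk E (λ v → P v × v ≢ z) x t
first-arrival w with last-exit (walk-reverse w)
... | inj₁ z≡x = inj₁ (sym z≡x)
... | inj₂ (t , e , w′) = inj₂ (t , e , walk-reverse w′)

data SimplePath (E : Fin n → Fin n → Set) : Fin n → Fin n → List (Fin n) → Set where
  end : ∀ {x} → SimplePath E x x (x ∷ [])
  cons : ∀ {x y z l} → All (_≢ x) l → E x y → SimplePath E y z l → SimplePath E x z (x ∷ l)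

module _ {E : Fin n → Fin n → Set} where

  simple-walk : ∀ {P : Fin n → Set} {x z l} → SimplePath E x z l → All P l → Walk E P x z
  simple-walk end (p ∷ []) = stop p
  simple-walk (cons _ e s) (p ∷ ps) = step p e (simple-walk s ps)

  loop-erase : ∀ {P : Fin n → Set} {x z} → Walk E P x z → ∃ λ l → SimplePath E x z l × All P l
  loop-erase (stop p) = _ , end , p ∷ []
  loop-erase {P} (step {x} p e w) with loop-erase w
  ... | l , s , ps with cut s ps
    where
    cut : ∀ {y z l} → SimplePath E y z l → All P l →
          All (_≢ x) l ⊎ ∃ λ m → SimplePath E x z m × All P m
    cut (end {y}) (p ∷ []) with y ≟ x
    ... | yes refl = inj₂ (_ , end , p ∷ [])
    ... | no y≢x = inj₁ (y≢x ∷ [])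
    cut {y} (cons a e s) (p ∷ ps) with y ≟ x
    ... | yes refl = inj₂ (_ , (cons a e s) , p ∷ ps)
    ... | no y≢x with cut s ps
    ...   | inj₁ as = inj₁ (y≢x ∷ as)
    ...   | inj₂ found = inj₂ found
  ...   | inj₁ x∉l = _ , (cons x∉l e s) , p ∷ ps
  ...   | inj₂ found = found

-- Abstract cacti and separation by a vertex

record Cactus (n q : ℕ) : Set₁ where
  field
    E : Fin n → Fin n → Set
    E? : ∀ a b → Dec (E a b)
    E-asym : ∀ {a b} → E a b → ¬ E b a
    connected : ∀ x y → Walk E (λ _ → ⊤) x y
    out-unique : ∀ {a b c y} → E a b → E a c → Avoiding E a b y → Avoiding E a c y → b ≡ c
    in-unique : ∀ {a b c y} → E b a → E c a → Avoiding E a y b → Avoiding E a y c → b ≡ c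
    InC : Fin q → Fin n → Fin n → Set
    InC? : ∀ i a b → Dec (InC i a b)
    InC⇒E : ∀ {i a b} → InC i a b → E a b
    cycle-of : ∀ {a b} → E a b → ∃ λ i → InC i a b
    cycle-unique : ∀ {i j a b} → InC i a b → InC j a b → i ≡ j
    cycle-arc : ∀ i → ∃₂ λ a b → InC i a b
    cycle-out : ∀ {i a b c} → InC i a b → InC i a c → b ≡ c
    cycle-in : ∀ {i a b c} → InC i b a → InC i c a → b ≡ c
    cycle-connected : ∀ {i a b c d} → InC i a b → InC i c d → Walk (InC i) (λ _ → ⊤) b c

-- The axioms are self-dual, with `out-unique` and `in-unique` exchanged; mirror images of lemmas
-- are obtained by applying them here.
reverse-cactus : Cactus n q → Cactus n q
reverse-cactus C = record
  { E = flip E ; E? = flip E? ; E-asym = flip E-asym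
  ; connected = λ x y → walk-reverse (connected y x)
  ; out-unique = λ e f v w → in-unique e f (walk-reverse v) (walk-reverse w)
  ; in-unique = λ e f v w → out-unique e f (walk-reverse v) (walk-reverse w)
  ; InC = λ i → flip (InC i) ; InC? = λ i → flip (InC? i) ; InC⇒E = InC⇒E
  ; cycle-of = cycle-of ; cycle-unique = cycle-unique
  ; cycle-arc = λ i → let a , b , c = cycle-arc i in b , a , c
  ; cycle-out = cycle-in ; cycle-in = cycle-out
  ; cycle-connected = λ c d → walk-reverse (cycle-connected d c)
  }
  where
  open Cactus C

-- Sep a x y says that a lies on the (unique) directed path from x to y.
module Separation (C : Cactus n q) where
  open Cactus C

  Av Sep : Fin n → Fin n → Fin n → Set
  Av = Avoiding E
  Sep a x y = ¬ Av a x y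

  E⇒≢ : ∀ {a b} → E a b → a ≢ b
  E⇒≢ e refl = E-asym e e

  av-edge : ∀ {a x y} → x ≢ a → E x y → y ≢ a → Av a x y
  av-edge p e q = step p e (stop q)

  sep-left : ∀ {x y} → Sep x x y
  sep-left w = walk-source w refl

  sep-right : ∀ {x y} → Sep y x y
  sep-right w = walk-target w refl

  succ : ∀ {x z} → x ≢ z → ∃ λ c → E x c × Av x c z
  succ {x} {z} x≢z with last-exit (connected x z)
  ... | inj₁ x≡z = contradiction x≡z x≢z
  ... | inj₂ (c , e , w) = c , e , walk-map id proj₂ w

  pred : ∀ {x z} → x ≢ z → ∃ λ t → E t z × Av z x t
  pred {x} {z} x≢z with first-arrival (connected x z)
  ... | inj₁ x≡z = contradiction x≡z x≢z
  ... | inj₂ (c , e , w) = c , e , walk-map id proj₂ w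

  -- A walk that misses u can be cut after its last visit to x. The arc taken there and x → u then
  -- open two walks to y that never return to x, so they are the same arc.
  sep-step : ∀ {x u y} → E x u → Av x u y → Sep u x y
  sep-step e w v with last-exit v
  ... | inj₁ refl = walk-target w refl
  ... | inj₂ (c , f , v′) =
    proj₁ (walk-source v′) (out-unique f e (walk-map id proj₂ v′) w)

  sep-split : ∀ {P : Fin n → Set} {y x z} → Sep y x z → Walk E P x z → Walk E P x y × Walk E P y z
  sep-split {y = y} s w with visit y w
  ... | inj₁ found = found
  ... | inj₂ w′ = contradiction w′ s

  sep-prefix : ∀ {w x y z} → Sep w x y → Sep y x z → Sep w x z
  sep-prefix s t v = s (proj₁ (sep-split t v))

  sep-suffix : ∀ {w x y z} → Sep w y z → Sep y x z → Sep w x z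
  sep-suffix s t v = s (proj₂ (sep-split t v))

  sep-antisym : ∀ {a b x} → Sep a x b → Sep b x a → a ≡ b
  sep-antisym {a} {b} {x} s t with a ≟ b
  ... | yes a≡b = a≡b
  ... | no a≢b with first-of-two a≢b (connected x a)
  ...   | inj₁ w = contradiction w s
  ...   | inj₂ w = contradiction w t

  -- It is enough to look for a on one loop-erased walk: by `sep-step`, every walk from x to y meets
  -- each vertex of it.
  av? : ∀ a x y → Av a x y ⊎ Sep a x y
  av? a x y = decide (proj₁ (proj₂ (loop-erase (connected x y))))
    where
    decide : ∀ {x y l} → SimplePath E x y l → Av a x y ⊎ Sep a x y
    decide (end {x}) with x ≟ a
    ... | yes refl = inj₂ sep-left
    ... | no x≢a = inj₁ (stop x≢a)
    decide {x} (cons x∉l e s) with x ≟ a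
    ... | yes refl = inj₂ sep-left
    ... | no x≢a with decide s
    ...   | inj₁ w = inj₁ (step x≢a e w)
    ...   | inj₂ sep = inj₂ (sep-suffix sep (sep-step e (simple-walk s x∉l)))

  sep-through : ∀ {a x y} z → Sep a x y → Sep a x z ⊎ Sep a z y
  sep-through {a} {x} {y} z s with av? a x z | av? a z y
  ... | inj₂ t | _ = inj₁ t
  ... | inj₁ _ | inj₂ t = inj₂ t
  ... | inj₁ v | inj₁ w = contradiction (walk-++ v w) s

  -- After its last visit to a, a walk from a to y must still meet b, since otherwise going from x
  -- by way of a to y would miss b. The part of it from b on avoids a.
  av-after : ∀ {a b x y} → Sep b x y → Av b x a → Av a b y
  av-after {a} {b} {x} {y} s v with last-exit (connected a y)
  ... | inj₁ refl = contradiction v s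
  ... | inj₂ (c , e , w) with av? b c y
  ...   | inj₂ t = walk-map id proj₂ (proj₂ (sep-split t w))
  ...   | inj₁ u = contradiction (walk-++ v (step (walk-target v) e u)) s

  av-tail : ∀ {b x y} → Sep b x y → x ≢ b → Av x b y
  av-tail s x≢b = av-after s (stop x≢b)

-- Paths described by their first and last arcs

module Betweenness (C : Cactus n q) where
  open Cactus C public
  open Separation C public
  private
    module Rev = Separation (reverse-cactus C)

  sep-step′ : ∀ {x v y} → E v y → Av y x v → Sep v x y
  sep-step′ e w v = Rev.sep-step e (walk-reverse w) (walk-reverse v)

  av-before : ∀ {a b x y} → Sep b x y → Av b a y → Av a x b
  av-before s v = walk-reverse (Rev.av-after (s ∘ walk-reverse) (walk-reverse v))

  av-init : ∀ {b x y} → Sep b x y → y ≢ b → Av y x b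
  av-init s y≢b = av-before s (stop y≢b)

  -- The directed path from α to δ starts with the arc α → β and ends with the arc γ → δ.
  Spans : Fin n → Fin n → Fin n → Fin n → Set
  Spans α β γ δ = α ≢ δ × Av α β γ × Av δ β γ

  spans? : ∀ α β γ δ → Spans α β γ δ ⊎ (α ≡ δ ⊎ Sep α β γ ⊎ Sep δ β γ)
  spans? α β γ δ with α ≟ δ | av? α β γ | av? δ β γ
  ... | yes p | _ | _ = inj₂ (inj₁ p)
  ... | no _ | inj₂ s | _ = inj₂ (inj₂ (inj₁ s))
  ... | no _ | inj₁ _ | inj₂ s = inj₂ (inj₂ (inj₂ s))
  ... | no p | inj₁ v | inj₁ w = inj₁ (p , v , w)

  -- An element (vertex or arc) is entered through α → β and left through γ → δ.
  data Link : Fin n → Fin n → Fin n → Fin n → Set where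
    vertex : ∀ {α β δ} → Link α β β δ
    arc : ∀ {α β} → Link α β α β

  -- Arcs that are not incident with the vertex nearest to r of their own cycle.
  Good : Fin n → Fin n → Fin n → Set
  Good r a b = E a b × Av a b r × Av b r a

  -- For an arc the two conditions coincide. For a vertex they concern the last arc of the path from
  -- r and the first arc of the path back to r.
  Generic : Fin n → Fin n → Fin n → Fin n → Fin n → Set
  Generic r α β γ δ = Good r α β × Good r γ δ × Link α β γ δ

-- Elements away from the gates clash pairwise

module Conflict₁ (C : Cactus n q) (r : Fin n) where
  open Betweenness C

  generic-tail : ∀ {α β γ δ} → Generic r α β γ δ → Sep α r γ
  generic-tail ((e , _ , w) , _ , vertex) = sep-step′ e w
  generic-tail (_ , _ , arc) = sep-right

  generic-head : ∀ {α β γ δ} → Generic r α β γ δ → Sep β r δ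
  generic-head (_ , (e , _ , w) , vertex) = sep-step′ e w
  generic-head (_ , _ , arc) = sep-right

  generic-entry : ∀ {α β γ δ z} → Generic r α β γ δ → Sep z r γ → Sep z r α ⊎ z ≡ β
  generic-entry (_ , _ , arc) s = inj₁ s
  generic-entry {α} {β} {z = z} ((e , _ , w) , _ , vertex) s with z ≟ β
  ... | yes z≡β = inj₂ z≡β
  ... | no z≢β with av? z r α
  ...   | inj₂ t = inj₁ t
  ...   | inj₁ v = contradiction (walk-∷ʳ v e (z≢β ∘ sym)) s

  -- The path from r to γ runs through α and then β and misses δ; its part from β on is the required
  -- one.
  spans-outward : ∀ {α β γ δ} → Av β r α → Sep α r β → Sep β r γ → Av δ r γ → Spans α β γ δ
  spans-outward u s t w =
    (λ { refl → s (proj₁ (sep-split t w)) }) , av-after t u , proj₂ (sep-split t w)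

  module _ {α β γ δ α′ β′ γ′ δ′} (X : Generic r α β γ δ) (Y : Generic r α′ β′ γ′ δ′)
           (n₁ : Av β′ r γ) (n₂ : Av β r γ′) where

    not-consecutive : α′ ≢ δ
    not-consecutive refl = sep-prefix (generic-head X) (generic-tail Y) n₂

    -- Each of α and α′ lies on the path from r to the other, so they coincide. Both entering arcs
    -- then continue to r without α, so their heads coincide too.
    same-entry : Sep α r γ′ → Sep α′ r γ → (α ≡ α′ × β ≡ β′ × γ ≢ β′ × γ′ ≢ β)
    same-entry s s′ with generic-entry Y s | generic-entry X s′
    ... | inj₂ refl | _ = contradiction n₁ (generic-tail X)
    ... | inj₁ _ | inj₂ refl = contradiction n₂ (generic-tail Y)
    ... | inj₁ t | inj₁ t′ with sep-antisym t t′
    ...   | refl = refl , same-head X Y , walk-target n₁ , walk-target n₂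
      where
      same-head : ∀ {a b c d e f g} → Generic r a b c d → Generic r a e f g → b ≡ e
      same-head ((e , v , _) , _) ((e′ , v′ , _) , _) = out-unique e e′ v v′

module Conflict₂ (C : Cactus n q) (r : Fin n) where
  open Betweenness C
  open Conflict₁ C r public
  private
    module Rev = Conflict₁ (reverse-cactus C) r

    rev-link : ∀ {α β γ δ} → Link α β γ δ → Betweenness.Link (reverse-cactus C) δ γ β α
    rev-link vertex = Betweenness.vertex
    rev-link arc = Betweenness.arc

    rev-good : ∀ {a b} → Good r a b → Betweenness.Good (reverse-cactus C) r b a
    rev-good (e , v , w) = e , walk-reverse w , walk-reverse v

    rev-generic : ∀ {α β γ δ} → Generic r α β γ δ →
                  Betweenness.Generic (reverse-cactus C) r δ γ β α
    rev-generic (g , h , l) = rev-good h , rev-good g , rev-link l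

    rev-spans : ∀ {α β γ δ} → Betweenness.Spans (reverse-cactus C) δ γ β α → Spans α β γ δ
    rev-spans (p , v , w) = p ∘ sym , walk-reverse w , walk-reverse v

  spans-inward : ∀ {α β γ δ} → Av γ δ r → Sep δ γ r → Sep γ β r → Av α β r → Spans α β γ δ
  spans-inward u s t w =
    rev-spans (Rev.spans-outward (walk-reverse u) (s ∘ walk-reverse)
                                 (t ∘ walk-reverse) (walk-reverse w))

  module _ {α β γ δ α′ β′ γ′ δ′} (X : Generic r α β γ δ) (Y : Generic r α′ β′ γ′ δ′)
           (distinct : ¬ (α ≡ α′ × β ≡ β′ × γ ≡ γ′))
           (n₁ : Av β′ r γ) (n₂ : Av β r γ′) (n₃ : Av γ′ β r) (n₄ : Av γ β′ r) where

    not-same-entry : Sep α r γ′ → Sep α′ r γ → ⊥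
    not-same-entry s s′ with same-entry X Y n₁ n₂ s s′ | proj₂ (proj₂ X) | proj₂ (proj₂ Y)
    ... | refl , refl , p , _ | vertex | _ = p refl
    ... | refl , refl , _ , p | _ | vertex = p refl
    ... | refl , refl , _ | arc | arc = distinct (refl , refl , refl)

    not-same-leaving : Sep δ β′ r → Sep δ′ β r → ⊥
    not-same-leaving s s′
      with Rev.same-entry (rev-generic X) (rev-generic Y) (walk-reverse n₃) (walk-reverse n₄)
                          (s ∘ walk-reverse) (s′ ∘ walk-reverse) | proj₂ (proj₂ X) | proj₂ (proj₂ Y)
    ... | refl , refl , p , _ | vertex | _ = p refl
    ... | refl , refl , _ , p | _ | vertex = p refl
    ... | refl , refl , _ | arc | arc = distinct (refl , refl , refl)

    private
      across : ∀ {P : Fin n → Set} {x y} → Walk E P x γ′ → P β′ → Walk E P β′ y → Walk E P x y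
      across = link Y
        where
        link : ∀ {P : Fin n → Set} {a b c d x y} → Generic r a b c d →
               Walk E P x c → P b → Walk E P b y → Walk E P x y
        link (_ , _ , vertex) v p w = walk-++ v w
        link ((e , _) , _ , arc) v p w = walk-++ (walk-∷ʳ v e p) w

    -- Y would lead from α to δ on a detour around X.
    no-detour : Sep α r γ′ → Sep δ β′ r → ⊥
    no-detour s t = go X refl refl
      where
      w₁ : Av β α γ′
      w₁ = proj₂ (sep-split s n₂)
      w₂ : Av γ β′ δ
      w₂ = proj₁ (sep-split t n₄)
      go : ∀ {a d} → Generic r a β γ d → a ≡ α → d ≡ δ → ⊥
      go ((e , _ , v) , (f , _ , v′) , vertex) refl refl =
        sep-step e (av-edge (E⇒≢ e ∘ sym) f δ≢α) (across w₁ (walk-source w₂) w₂)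
        where
        δ≢α : δ ≢ α
        δ≢α refl = sep-step′ e v v′
      -- Here X is the arc α → β itself. The detour reaches β without returning to α, so it would
      -- have to leave α through X, although its part up to γ′ misses β. The case γ′ = α, where that
      -- part is empty, is left to `meet`.
      go ((e , v , _) , _ , arc) refl refl with last-exit w₁
      ... | inj₂ (c , f , u) = proj₁ (walk-source u)
              (out-unique f e (across (walk-map id proj₂ u) (walk-source w₂) w₂)
                              (stop (E⇒≢ e ∘ sym)))
      ... | inj₁ refl = meet Y refl refl w₂ distinct
        where
        meet : ∀ {a b c d} → Generic r a b c d → c ≡ α → b ≡ β′ → Av α β′ β →
               ¬ (α ≡ a × β ≡ β′ × α ≡ α) → ⊥
        meet (_ , _ , vertex) refl refl w d = walk-source w refl
        meet ((e′ , _) , _ , arc) refl refl w d =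
          d (refl , out-unique e e′ (stop (E⇒≢ e ∘ sym)) w , refl)

  -- If one element lies on the path from r to the other, or on the other's path back to r, this
  -- path contains both. Otherwise the paths from X to Y and from Y to X are tried, and every way in
  -- which both can fail is contradictory.
  generic-conflict : ∀ {α β γ δ α′ β′ γ′ δ′} → Generic r α β γ δ → Generic r α′ β′ γ′ δ′ →
                     ¬ (α ≡ α′ × β ≡ β′ × γ ≡ γ′) → Spans α β γ′ δ′ ⊎ Spans α′ β′ γ δ
  generic-conflict {α} {β} {γ} {δ} {α′} {β′} {γ′} {δ′}
    X@((e , v , w) , (f , x , y) , l) Y@((e′ , v′ , w′) , (f′ , x′ , y′) , l′) distinct
    with av? β′ r γ | av? β r γ′ | av? γ′ β r | av? γ β′ r
  ... | inj₂ s | _ | _ | _ = inj₂ (spans-outward w′ (sep-step′ e′ w′) s y)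
  ... | _ | inj₂ s | _ | _ = inj₁ (spans-outward w (sep-step′ e w) s y′)
  ... | _ | _ | inj₂ s | _ = inj₁ (spans-inward x′ (sep-step f′ x′) s v)
  ... | _ | _ | _ | inj₂ s = inj₂ (spans-inward x (sep-step f x) s v′)
  ... | inj₁ n₁ | inj₁ n₂ | inj₁ n₃ | inj₁ n₄ with spans? α β γ′ δ′ | spans? α′ β′ γ δ
  ...   | inj₁ sp | _ = inj₁ sp
  ...   | _ | inj₁ sp = inj₂ sp
  ...   | inj₂ (inj₁ p) | _ = ⊥-elim (not-consecutive Y X n₂ n₁ p)
  ...   | _ | inj₂ (inj₁ p) = ⊥-elim (not-consecutive X Y n₁ n₂ p)
  -- Each candidate path is now blocked by the tail of its first arc or by the head of its last arc.
  -- Goodness of these arcs allows the blockage to be moved to a path from r or to r.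
  ...   | inj₂ (inj₂ s) | inj₂ (inj₂ s′) = ⊥-elim (go s s′)
    where
    outer : ∀ {a b c} → Av a b r → Sep a b c → Sep a r c
    outer u t with sep-through r t
    ... | inj₁ t′ = contradiction u t′
    ... | inj₂ t′ = t′
    inner : ∀ {a b c} → Av a r c → Sep a b c → Sep a b r
    inner u t with sep-through r t
    ... | inj₁ t′ = t′
    ... | inj₂ t′ = contradiction u t′
    go : Sep α β γ′ ⊎ Sep δ′ β γ′ → Sep α′ β′ γ ⊎ Sep δ β′ γ → ⊥
    go (inj₁ t) (inj₁ t′) = not-same-entry X Y distinct n₁ n₂ n₃ n₄ (outer v t) (outer v′ t′)
    go (inj₂ t) (inj₂ t′) = not-same-leaving X Y distinct n₁ n₂ n₃ n₄ (inner y t′) (inner y′ t)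
    go (inj₁ t) (inj₂ t′) = no-detour X Y distinct n₁ n₂ n₃ n₄ (outer v t) (inner y t′)
    go (inj₂ t) (inj₁ t′) =
      no-detour Y X (λ { (p , q , s) → distinct (sym p , sym q , sym s) })
                n₂ n₁ n₄ n₃ (outer v′ t′) (inner y′ t)

-- Clashes, and the special elements at the root

data Element (n : ℕ) : Set where
  vert : Fin n → Element n
  arrow : Fin n → Fin n → Element n

module Clashes (C : Cactus n q) where
  open Betweenness C

  data Enters : Element n → Fin n → Fin n → Set where
    vert : ∀ {α u} → E α u → Enters (vert u) α u
    arrow : ∀ {α β} → E α β → Enters (arrow α β) α β

  data Leaves : Element n → Fin n → Fin n → Set where
    vert : ∀ {u δ} → E u δ → Leaves (vert u) u δ
    arrow : ∀ {γ δ} → E γ δ → Leaves (arrow γ δ) γ δ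

  -- The path runs from the tail of the entering arc to the head of the leaving arc, so that a
  -- vertex among the two elements is interior and its colour counts.
  Precedes : Element n → Element n → Set
  Precedes e f = ∃₂ λ α β → ∃₂ λ γ δ → Enters e α β × Leaves f γ δ × Spans α β γ δ

  Clash : Element n → Element n → Set
  Clash e f = Precedes e f ⊎ Precedes f e

  clash-sym : ∀ {e f} → Clash e f → Clash f e
  clash-sym (inj₁ p) = inj₂ p
  clash-sym (inj₂ p) = inj₁ p

module OutArc (C : Cactus n q) {r o : Fin n} (ro : Cactus.E C r o) where
  open Betweenness C

  -- The last arc on the way from β to o and the arc r → o both start at vertices that r reaches
  -- without o, so they are the same arc: β meets r before o.
  branch-return : ∀ {β} → Av o r β → Av o β r
  branch-return v with pred (walk-target v)
  ... | t , e , w with in-unique ro e (stop (E⇒≢ ro)) (walk-++ v w)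
  ...   | refl = w

  into-branch : ∀ {γ δ} → Sep o r γ → Av δ r γ → Spans r o γ δ
  into-branch s v = walk-source v , av-tail s (E⇒≢ ro) , proj₂ (sep-split s v)

  before-root-arc : ∀ {α β γ} → Av α β r → Sep α r γ → Av o r γ → Av o r β → Spans α β r o
  before-root-arc v s w u = (λ { refl → s w }) , v , branch-return u

  -- One arc is added to the path of `before-root-arc`, which makes o an interior vertex.
  before-out : ∀ {α β γ δ} → Av α β r → Sep α r γ → Av o r γ → Av o r β → E o δ → Spans α β o δ
  before-out {α} {β} {γ} {δ} v s w u f =
    (λ { refl → sep-prefix o-sep s w }) , walk-∷ʳ v ro (λ { refl → s w }) , avoid
    where
    o-sep : Sep o r δ
    o-sep = sep-step ro (av-edge (E⇒≢ ro ∘ sym) f (λ { refl → E-asym ro f }))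
    avoid : Av δ β o
    avoid with av? δ β r
    ... | inj₁ x = walk-∷ʳ x ro (E⇒≢ f)
    ... | inj₂ t = contradiction (walk-++ u (proj₁ (sep-split t (branch-return u)))) o-sep

module InArc (C : Cactus n q) {r i : Fin n} (ir : Cactus.E C i r) where
  open Betweenness C
  private
    module Rev = OutArc (reverse-cactus C) ir

    rev-spans : ∀ {α β γ δ} → Betweenness.Spans (reverse-cactus C) δ γ β α → Spans α β γ δ
    rev-spans (p , v , w) = p ∘ sym , walk-reverse w , walk-reverse v

  out-of-branch : ∀ {α β} → Sep i β r → Av α β r → Spans α β i r
  out-of-branch s v = rev-spans (Rev.into-branch (s ∘ walk-reverse) (walk-reverse v))

  after-root-arc : ∀ {β γ δ} → Av δ r γ → Sep δ β r → Av i β r → Av i γ r → Spans i r γ δ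
  after-root-arc v s w u =
    rev-spans (Rev.before-root-arc (walk-reverse v) (s ∘ walk-reverse)
                                   (walk-reverse w) (walk-reverse u))

  after-in : ∀ {α β γ δ} → Av δ r γ → Sep δ β r → Av i β r → Av i γ r → E α i → Spans α i γ δ
  after-in v s w u e =
    rev-spans (Rev.before-out (walk-reverse v) (s ∘ walk-reverse)
                              (walk-reverse w) (walk-reverse u) e)

-- The hypothesis `oi` expresses that r → o and i → r lie on different cycles: on a common cycle the
-- path from r to i would begin with r → o.
module Special (C : Cactus n q) {r o i : Fin n}
               (ro : Cactus.E C r o) (ir : Cactus.E C i r)
               (oi : Avoiding (Cactus.E C) o r i) where
  open Betweenness C
  open Clashes C
  open Conflict₂ C r
  open OutArc C ro
  open InArc C ir

  data OutEnd : Element n → Set where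
    vert : OutEnd (vert o)
    arrow : OutEnd (arrow r o)

  data InEnd : Element n → Set where
    vert : InEnd (vert i)
    arrow : InEnd (arrow i r)

  data GenericElement : Element n → Fin n → Fin n → Fin n → Fin n → Set where
    vert : ∀ {a u b} → Generic r a u u b → GenericElement (vert u) a u u b
    arrow : ∀ {a b} → Generic r a b a b → GenericElement (arrow a b) a b a b

  enter-out : ∀ {e} → OutEnd e → Enters e r o
  enter-out vert = vert ro
  enter-out arrow = arrow ro

  leave-in : ∀ {e} → InEnd e → Leaves e i r
  leave-in vert = vert ir
  leave-in arrow = arrow ir

  generic : ∀ {e α β γ δ} → GenericElement e α β γ δ → Generic r α β γ δ
  generic (vert g) = g
  generic (arrow g) = g

  enter-generic : ∀ {e α β γ δ} → GenericElement e α β γ δ → Enters e α β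
  enter-generic (vert ((e , _) , _)) = vert e
  enter-generic (arrow ((e , _) , _)) = arrow e

  leave-generic : ∀ {e α β γ δ} → GenericElement e α β γ δ → Leaves e γ δ
  leave-generic (vert (_ , (e , _) , _)) = vert e
  leave-generic (arrow (_ , (e , _) , _)) = arrow e

  -- The arc α → β can be followed on a directed path to r that misses o.
  Approach : Fin n → Fin n → Set
  Approach α β = ∃ λ γ → Av α β r × Sep α r γ × Av o r γ × Av o r β

  approach-root : ∀ {e α β} → Enters e α β → Approach α β → Precedes e (vert r)
  approach-root e (_ , v , s , w , u) = _ , _ , _ , _ , e , vert ro , before-root-arc v s w u

  approach-out : ∀ {e f α β} → Enters e α β → Approach α β → OutEnd f → Precedes e f
  approach-out e (_ , v , s , w , u) arrow =
    _ , _ , _ , _ , e , arrow ro , before-root-arc v s w u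
  approach-out e (_ , v , s , w , u) vert with succ (E⇒≢ ro ∘ sym)
  ... | _ , f , _ = _ , _ , _ , _ , e , vert f , before-out v s w u f

  root-approach : Approach i r
  root-approach = i , stop (E⇒≢ ir ∘ sym) , sep-right , oi , stop (E⇒≢ ro)

  in-approach : ∀ {e} → InEnd e → ∃₂ λ α β → Enters e α β × Approach α β
  in-approach arrow = i , r , arrow ir , root-approach
  in-approach vert with pred (E⇒≢ ir ∘ sym)
  ... | α , e , v = α , i , vert e , i ,
    av-edge (E⇒≢ e ∘ sym) ir (λ { refl → E-asym e ir }) , sep-step′ e v , oi , oi

  generic-approach : ∀ {α β γ δ} → Generic r α β γ δ → Av o r γ → Approach α β
  generic-approach {γ = γ} g@((e , v , w) , _ , l) u = γ , v , generic-tail g , u , reach l u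
    where
    reach : ∀ {γ δ} → Link _ _ γ δ → Av o r γ → Av o r _
    reach vertex u = u
    reach arc u = walk-∷ʳ u e
      (λ { refl → walk-target v (in-unique ro e (stop (E⇒≢ ro)) u) })

  generic-exit : ∀ {α β γ δ} → Generic r α β γ δ → Sep δ β r
  generic-exit (_ , (f , x , _) , vertex) = sep-step f x
  generic-exit (_ , _ , arc) = sep-left

  generic-back : ∀ {α β γ δ} → Generic r α β γ δ → Av i β r → Av i γ r
  generic-back (_ , _ , vertex) x = x
  generic-back ((e , v , w) , _ , arc) x =
    step (λ { refl → walk-source w (sym (out-unique e ir v (stop (E⇒≢ ir ∘ sym)))) }) e x

  -- Otherwise the walk that goes from r through o and the element and on to i would put o on the
  -- path from r to i, against `oi`.
  generic-off-in : ∀ {α β γ δ} → Generic r α β γ δ → Sep o r γ → Av i β r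
  generic-off-in {α} {β} ((e , v , w) , _ , l) s = avβ
    where
    forward : ∀ {γ δ} → Link α β γ δ → Av r o γ → Av r β i → Av r o i
    forward vertex x y = walk-++ x y
    forward arc x y = walk-++ (walk-∷ʳ x e (walk-source y)) y
    avβ : Av i β r
    avβ with av? i β r
    ... | inj₁ x = x
    ... | inj₂ t = contradiction oi
            (sep-step ro (forward l (av-tail s (E⇒≢ ro)) (av-init t (E⇒≢ ir ∘ sym))))

  generic-out-clash : ∀ {e f α β γ δ} → GenericElement e α β γ δ → OutEnd f → Clash e f
  generic-out-clash {γ = γ} g o∈ with av? o r γ | generic g
  ... | inj₁ v | X = inj₁ (approach-out (enter-generic g) (generic-approach X v) o∈)
  ... | inj₂ s | _ , (_ , _ , w) , _ =
    inj₂ (_ , _ , _ , _ , enter-out o∈ , leave-generic g , into-branch s w)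

  -- The order depends on the branch: an element that is not beyond o precedes r, which is left
  -- through r → o; one beyond o follows r, which is entered through i → r.
  generic-root-clash : ∀ {e α β γ δ} → GenericElement e α β γ δ → Clash e (vert r)
  generic-root-clash {γ = γ} g with av? o r γ | generic g
  ... | inj₁ v | X = inj₁ (approach-root (enter-generic g) (generic-approach X v))
  ... | inj₂ s | X@(_ , (_ , _ , y) , _) with generic-off-in X s
  ...   | w = inj₂ (_ , _ , _ , _ , vert ir , leave-generic g ,
                    after-root-arc y (generic-exit X) w (generic-back X w))

  generic-in-clash : ∀ {e f α β γ δ} → GenericElement e α β γ δ → InEnd f → Clash e f
  generic-in-clash {β = β} g i∈ with av? i β r | generic g
  ... | inj₂ s | (_ , v , _) , _ =
    inj₁ (_ , _ , _ , _ , enter-generic g , leave-in i∈ , out-of-branch s v)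
  ... | inj₁ w | X@(_ , (_ , _ , y) , _) = inj₂ (go i∈)
    where
    go : ∀ {f} → InEnd f → Precedes f _
    go arrow = _ , _ , _ , _ , arrow ir , leave-generic g ,
               after-root-arc y (generic-exit X) w (generic-back X w)
    go vert with pred (E⇒≢ ir ∘ sym)
    ... | _ , e , _ = _ , _ , _ , _ , vert e , leave-generic g ,
                      after-in y (generic-exit X) w (generic-back X w) e

  generic-generic-clash : ∀ {e f α β γ δ α′ β′ γ′ δ′} →
    GenericElement e α β γ δ → GenericElement f α′ β′ γ′ δ′ → e ≢ f → Clash e f
  generic-generic-clash g h e≢f
    with generic-conflict (generic g) (generic h) (λ { (refl , refl , refl) → e≢f (same g h) })
    where
    same : ∀ {e f α β γ δ δ′} → GenericElement e α β γ δ → GenericElement f α β γ δ′ → e ≡ f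
    same (vert _) (vert _) = refl
    same (arrow _) (arrow _) = refl
    same (vert ((e , _) , _)) (arrow _) = contradiction refl (E⇒≢ e)
    same (arrow ((e , _) , _)) (vert _) = contradiction refl (E⇒≢ e)
  ... | inj₁ sp = inj₁ (_ , _ , _ , _ , enter-generic g , leave-generic h , sp)
  ... | inj₂ sp = inj₂ (_ , _ , _ , _ , enter-generic h , leave-generic g , sp)

  data Core : Element n → Set where
    root : Core (vert r)
    out : ∀ {e} → OutEnd e → Core e
    inn : ∀ {e} → InEnd e → Core e

  private
    out-out : ∀ {e f} → OutEnd e → OutEnd f → e ≢ f → Clash e f
    out-out vert vert e≢f = contradiction refl e≢f
    out-out arrow arrow e≢f = contradiction refl e≢f
    out-out arrow vert _ with succ (E⇒≢ ro ∘ sym)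
    ... | _ , f , _ = inj₁ (_ , _ , _ , _ , arrow ro , vert f ,
      (λ { refl → E-asym ro f }) , stop (E⇒≢ ro ∘ sym) , stop (E⇒≢ f))
    out-out vert arrow e≢f = clash-sym (out-out arrow vert (e≢f ∘ sym))

    in-in : ∀ {e f} → InEnd e → InEnd f → e ≢ f → Clash e f
    in-in vert vert e≢f = contradiction refl e≢f
    in-in arrow arrow e≢f = contradiction refl e≢f
    in-in vert arrow _ with pred (E⇒≢ ir ∘ sym)
    ... | _ , e , _ = inj₁ (_ , _ , _ , _ , vert e , arrow ir ,
      (λ { refl → E-asym e ir }) , stop (E⇒≢ e ∘ sym) , stop (E⇒≢ ir))
    in-in arrow vert e≢f = clash-sym (in-in vert arrow (e≢f ∘ sym))

    in-out : ∀ {e f} → InEnd e → OutEnd f → Precedes e f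
    in-out i∈ o∈ with in-approach i∈
    ... | _ , _ , e , a = approach-out e a o∈

    in-root : ∀ {e} → InEnd e → Precedes e (vert r)
    in-root i∈ with in-approach i∈
    ... | _ , _ , e , a = approach-root e a

  core-clash : ∀ {e f} → Core e → Core f → e ≢ f → Clash e f
  core-clash root root e≢f = contradiction refl e≢f
  core-clash root (out o∈) _ = inj₁ (approach-out (vert ir) root-approach o∈)
  core-clash root (inn i∈) _ = inj₂ (in-root i∈)
  core-clash (out o∈) root _ = inj₂ (approach-out (vert ir) root-approach o∈)
  core-clash (out o∈) (out o∈′) e≢f = out-out o∈ o∈′ e≢f
  core-clash (out o∈) (inn i∈) _ = inj₂ (in-out i∈ o∈)
  core-clash (inn i∈) root _ = inj₁ (in-root i∈)
  core-clash (inn i∈) (out o∈) _ = inj₁ (in-out i∈ o∈)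
  core-clash (inn i∈) (inn i∈′) e≢f = in-in i∈ i∈′ e≢f

  generic-core-clash : ∀ {e f α β γ δ} → GenericElement e α β γ δ → Core f → Clash e f
  generic-core-clash g root = generic-root-clash g
  generic-core-clash g (out o∈) = generic-out-clash g o∈
  generic-core-clash g (inn i∈) = generic-in-clash g i∈

-- The extra elements at a cut-vertex close to the root

-- Here the path from r to v is r → v or r → x → v, and j → v lies on another cycle than its
-- last arc.
module Extra (C : Cactus n q) {r o i x v j : Fin n}
             (ro : Cactus.E C r o) (ir : Cactus.E C i r)
             (rx : Cactus.E C r x) (o≢x : o ≢ x) (xv : Avoiding (Cactus.E C) r x v)
             (vi : Avoiding (Cactus.E C) r v i)
             (jv : Cactus.E C j v) (vj : ¬ Avoiding (Cactus.E C) v r j) where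
  open Betweenness C
  open Clashes C
  open Conflict₂ C r

  oi : Av o r i
  oi with av? o r i
  ... | inj₁ w = w
  ... | inj₂ s = contradiction
          (out-unique ro rx (av-tail s (E⇒≢ ro)) (walk-++ xv vi)) o≢x

  open Special C ro ir oi public

  r≢v : r ≢ v
  r≢v r≡v = walk-source vi (sym r≡v)

  j≢v : j ≢ v
  j≢v = E⇒≢ jv

  r≢j : r ≢ j
  r≢j refl = vj (stop r≢v)

  -- A walk from z to r without v could be prolonged to the predecessor of v on the path from r. By
  -- `in-unique` this predecessor would be j, which r reaches only through v.
  beyond : ∀ {z} → Av v z j → Sep v z r
  beyond u w with pred r≢v
  ... | t , e , y with in-unique e jv (walk-++ w y) u
  ...   | refl = vj y

  -- If z reached v without j, the arc that leaves j towards z and the arc j → v would open two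
  -- walks to v that never return to j. They would be the same arc, yet the way from j to z avoids
  -- v.
  sep-flip : ∀ {j v z} → E j v → Sep j v z → Sep j z v
  sep-flip e s u with last-exit (av-tail s (E⇒≢ e ∘ sym))
  ... | inj₁ refl = walk-source u refl
  ... | inj₂ (c , f , w) = proj₁ (walk-source w)
    (out-unique f e (walk-++ (walk-map id proj₂ w) u) (stop (E⇒≢ e ∘ sym)))

  j-return : Av j v r
  j-return with av? j v r
  ... | inj₁ w = w
  ... | inj₂ s = contradiction (av-tail s (j≢v ∘ sym)) (beyond (stop j≢v))

  below-precedes : ∀ {α β} → Av α β r → Av v β j → Spans α β j v
  below-precedes a w = walk-target a′ ∘ sym , proj₁ (sep-split (sep-step′ jv w) a′) , w
    where
    a′ = proj₁ (sep-split (beyond w) a)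

  below-forward : ∀ {α β γ δ} → Generic r α β γ δ → Av v γ j → Av v β j
  below-forward (_ , _ , vertex) w = w
  below-forward {α} {β} ((e , x , y) , _ , arc) w with av? v β j
  ... | inj₁ u = u
  ... | inj₂ s with α ≟ j
  ...   | yes refl = contradiction
            (subst (λ b → Av b r j) (out-unique e jv x (av-tail (beyond w) j≢v)) y) vj
  ...   | no α≢j = av-init through (j≢v ∘ sym)
    where
    through : Sep j β v
    through u = sep-step′ jv w (step α≢j e u)

  module _ {α β γ δ} (X : Generic r α β γ δ) (near : Sep γ r v → γ ≡ v) (s : Sep v γ j) where

    private
      leaves : E γ δ
      leaves = proj₁ (proj₁ (proj₂ X))

      j-off : Av j v γ
      j-off with av? j v γ
      ... | inj₁ w = w
      ... | inj₂ t = contradiction (av-init (sep-flip jv t) (j≢v ∘ sym)) s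

      δ-off : Av δ v γ
      δ-off with av? δ v γ
      ... | inj₁ w = w
      -- γ precedes δ on the path from r, so it lies on the path from r to v or on that from v to δ.
      -- The second contradicts δ preceding γ on the way from v; in the first, `near` makes γ equal
      -- to v.
      ... | inj₂ t with sep-through v (sep-step′ leaves (proj₂ (proj₂ (proj₁ (proj₂ X)))))
      ...   | inj₂ u = contradiction (sep-antisym u t) (E⇒≢ leaves)
      ...   | inj₁ u with near u
      ...     | refl = contradiction (stop (E⇒≢ leaves)) t

      j≢δ : j ≢ δ
      j≢δ refl = s (av-edge (λ { refl → E-asym leaves jv }) leaves j≢v)

    arrow-precedes : Spans j v γ δ
    arrow-precedes = j≢δ , j-off , δ-off

    vert-precedes : ∀ {a} → E a j → Spans a j γ δ
    vert-precedes {a} e = a≢δ , step (E⇒≢ e ∘ sym) jv a-off , step j≢δ jv δ-off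
      where
      a≢v : a ≢ v
      a≢v refl = E-asym e jv
      a-off : Av a v γ
      a-off with av? a v γ
      ... | inj₁ w = w
      ... | inj₂ t = contradiction (walk-∷ʳ (av-init back (a≢v ∘ sym)) e j≢v) s
        where
        back : Sep a γ v
        back u with last-exit (proj₂ (sep-split t j-off))
        ... | inj₁ refl = walk-source u refl
        ... | inj₂ (c , f , w) = proj₁ (walk-source w)
              (out-unique f e (walk-++ (walk-map id proj₂ w) u)
                              (av-edge (E⇒≢ e ∘ sym) jv (a≢v ∘ sym)))
      a≢δ : a ≢ δ
      a≢δ refl with γ ≟ v
      ... | yes refl = beyond (av-edge a≢v e j≢v) (proj₁ (proj₂ (proj₁ (proj₂ X))))
      ... | no γ≢v = s (step γ≢v leaves (av-edge a≢v e j≢v))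

  data ExtraEnd : Element n → Set where
    vert : ExtraEnd (vert j)
    arrow : ExtraEnd (arrow j v)

  leave-extra : ∀ {e} → ExtraEnd e → Leaves e j v
  leave-extra vert = vert jv
  leave-extra arrow = arrow jv

  -- If γ reaches j without v, the element precedes j → v; otherwise the path from j through v meets
  -- it. The hypothesis rules out, in particular, the last arc of the path from r to v, which cannot
  -- share a path with j → v because both enter v.
  generic-extra-clash : ∀ {e f α β γ δ} → GenericElement e α β γ δ →
                        (Sep γ r v → γ ≡ v) → ExtraEnd f → Clash e f
  generic-extra-clash {β = β} {γ} g near j∈ with av? v γ j | generic g
  ... | inj₁ w | X@((_ , a , _) , _) =
    inj₁ (_ , _ , _ , _ , enter-generic g , leave-extra j∈ , below-precedes a (below-forward X w))
  ... | inj₂ s | X = inj₂ (go j∈)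
    where
    go : ∀ {f} → ExtraEnd f → Precedes f _
    go arrow = _ , _ , _ , _ , arrow jv , leave-generic g , arrow-precedes X near s
    go vert with pred r≢j
    ... | _ , e , _ = _ , _ , _ , _ , vert e , leave-generic g , vert-precedes X near s e

  private
    o-off-v : Av o r v
    o-off-v with av? o r v
    ... | inj₁ w = w
    ... | inj₂ s = contradiction (out-unique ro rx (av-tail s (E⇒≢ ro)) xv) o≢x

    o-off-j : Av o r j
    o-off-j with av? o r j
    ... | inj₁ w = w
    ... | inj₂ s = contradiction
      (out-unique ro rx (av-tail s (E⇒≢ ro)) (walk-++ xv (av-tail vj r≢v))) o≢x

    i-after : Sep i j r
    i-after = sep-step′ ir (step (r≢j ∘ sym) jv vi)

  -- One entering arc per element serves for all clashes with the core: the way back to r ends with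
  -- i → r by `vi`, and it can be prolonged by r → o.
  extra-approach : ∀ {e} → ExtraEnd e →
                   ∃₂ λ α β → Enters e α β × Approach α β × Spans α β i r
  extra-approach arrow = j , v , arrow jv , (j , j-return , sep-right , o-off-j , o-off-v) ,
    (r≢j ∘ sym) , proj₁ (sep-split i-after′ j-return) , vi
    where
    i-after′ : Sep i v r
    i-after′ = sep-step′ ir vi
  extra-approach vert with pred r≢j
  ... | a , e , w = a , j , vert e , (j , back , sep-step′ e w , o-off-j , o-off-j) ,
    a≢r , proj₁ (sep-split i-after back) , step (r≢j ∘ sym) jv vi
    where
    a≢v : a ≢ v
    a≢v refl = E-asym e jv
    a≢r : a ≢ r
    a≢r refl = vj (av-edge r≢v e j≢v)
    a-return : Av a v r
    a-return with av? a v r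
    ... | inj₁ w = w
    ... | inj₂ s = contradiction (av-tail s (a≢v ∘ sym)) (beyond (av-edge a≢v e j≢v))
    back : Av a j r
    back = step (E⇒≢ e ∘ sym) jv a-return

  extra-core-clash : ∀ {e f} → ExtraEnd e → Core f → Clash e f
  extra-core-clash j∈ f with extra-approach j∈
  extra-core-clash j∈ root | _ , _ , e , a , _ = inj₁ (approach-root e a)
  extra-core-clash j∈ (out o∈) | _ , _ , e , a , _ = inj₁ (approach-out e a o∈)
  extra-core-clash j∈ (inn i∈) | _ , _ , e , _ , sp = inj₁ (_ , _ , _ , _ , e , leave-in i∈ , sp)

  extra-extra-clash : ∀ {e f} → ExtraEnd e → ExtraEnd f → e ≢ f → Clash e f
  extra-extra-clash vert vert e≢f = contradiction refl e≢f
  extra-extra-clash arrow arrow e≢f = contradiction refl e≢f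
  extra-extra-clash vert arrow _ with pred r≢j
  ... | _ , e , _ = inj₁ (_ , _ , _ , _ , vert e , arrow jv ,
    (λ { refl → E-asym e jv }) , stop (E⇒≢ e ∘ sym) , stop j≢v)
  extra-extra-clash arrow vert e≢f = clash-sym (extra-extra-clash vert arrow (e≢f ∘ sym))

-- Gates of the cycles and marked vertices

module Gates₁ (C : Cactus n q) (r : Fin n) where
  open Betweenness C

  -- The gate w is recognised without distances: r reaches it before b, and b returns to r only
  -- through it.
  OutGate : Fin q → Fin n → Fin n → Set
  OutGate c w b = InC c w b × Av b r w × Sep w b r

  -- If r reached z without w, going from w by way of r to z and going from w along the cycle to z
  -- would leave w through the same arc, so b would reach r without w.
  out-gate-first : ∀ {c w b z z′} → OutGate c w b → InC c z z′ → Sep w r z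
  out-gate-first {c} {w} {b} {z} (cw , _ , s) cz v
    with last-exit (step tt cw (cycle-connected cw cz))
  ... | inj₁ refl = walk-target v refl
  ... | inj₂ (b′ , cb , u) with succ (walk-source v ∘ sym)
  ...   | t , e , y = s (subst (λ b → Av w b r) t≡b y)
    where
    u′ : Av w b z
    u′ = walk-map InC⇒E proj₂ (subst (λ b → Walk (InC c) _ b z) (cycle-out cb cw) u)
    t≡b = out-unique e (InC⇒E cw) (walk-++ y v) u′

  out-gate-unique : ∀ {c w b w′ b′} → OutGate c w b → OutGate c w′ b′ → b ≡ b′
  out-gate-unique g@(cw , _) g′@(cw′ , _)
    with sep-antisym (out-gate-first g cw′) (out-gate-first g′ cw)
  ... | refl = cycle-out cw cw′

  out-gate-cycle : ∀ {c c′ w w′ b} → OutGate c w b → OutGate c′ w′ b → c ≡ c′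
  out-gate-cycle (cw , v , _) (cw′ , v′ , _)
    with in-unique (InC⇒E cw) (InC⇒E cw′) v v′
  ... | refl = cycle-unique cw cw′

  OnCycle : Fin q → Fin n → Set
  OnCycle c z = ∃ λ z′ → InC c z z′

  -- The gate is the first vertex of the cycle on a walk from r. If the walk enters it at all, it
  -- does so from a vertex outside the cycle; were b to reach r without w, `in-unique` would
  -- identify this vertex with the predecessor of w on the cycle.
  out-gate-exists : ∀ c → ∃₂ λ w b → OutGate c w b
  out-gate-exists c with cycle-arc c
  ... | a , a′ , ca with first-hit on? (connected r a) (a′ , ca)
    where
    on? : ∀ z → Dec (OnCycle c z)
    on? z = any? (InC? c z)
  ... | w , (b , cw) , entry = w , b , cw , reach entry , back entry
    where
    w≢b : w ≢ b
    w≢b = E⇒≢ (InC⇒E cw)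
    on-b : OnCycle c b
    on-b with cycle-connected cw cw
    ... | stop _ = b , cw
    ... | step _ cb _ = _ , cb
    off : ∀ {v z} → OnCycle c z → ¬ OnCycle c v → v ≢ z
    off onz offv refl = offv onz
    reach : r ≡ w ⊎ (∃ λ t → E t w × Walk E (λ v → ¬ OnCycle c v) r t) → Av b r w
    reach (inj₁ refl) = stop w≢b
    reach (inj₂ (t , e , u)) = walk-∷ʳ (walk-map id (off on-b) u) e w≢b
    back : r ≡ w ⊎ (∃ λ t → E t w × Walk E (λ v → ¬ OnCycle c v) r t) → Sep w b r
    back (inj₁ refl) = sep-right
    back (inj₂ (t , e , u)) v with first-arrival (cycle-connected cw cw)
    ... | inj₁ b≡w = w≢b (sym b≡w)
    ... | inj₂ (t′ , ct , u′) = walk-target u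
      (subst (OnCycle c) (in-unique (InC⇒E ct) e (walk-map InC⇒E proj₂ u′)
                           (walk-++ v (walk-map id (off (b , cw)) u)))
                (w , ct))

module Gates (C : Cactus n q) (r : Fin n) where
  open Betweenness C
  open Gates₁ C r public
  private
    module Rev = Gates₁ (reverse-cactus C) r

  InGate : Fin q → Fin n → Fin n → Set
  InGate c b w = InC c b w × Av b w r × Sep w r b

  private
    rev-gate : ∀ {c b w} → InGate c b w → Rev.OutGate c w b
    rev-gate (cw , v , s) = cw , walk-reverse v , s ∘ walk-reverse

  in-gate-unique : ∀ {c w b w′ b′} → InGate c b w → InGate c b′ w′ → b ≡ b′
  in-gate-unique g g′ = Rev.out-gate-unique (rev-gate g) (rev-gate g′)

  in-gate-cycle : ∀ {c c′ w w′ b} → InGate c b w → InGate c′ b w′ → c ≡ c′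
  in-gate-cycle g g′ = Rev.out-gate-cycle (rev-gate g) (rev-gate g′)

  in-gate-exists : ∀ c → ∃₂ λ w b → InGate c b w
  in-gate-exists c with Rev.out-gate-exists c
  ... | w , b , cw , v , s = w , b , cw , walk-reverse v , s ∘ walk-reverse

  -- If w ≠ w′, the path from r to w passes w′. Hence w reaches w′ both through b and by way of r,
  -- and both ways leave w through the same arc, so b would return to r without w. If w = w′, there
  -- are opposite arcs.
  gates-disjoint : ∀ {c c′ w w′ b} → OutGate c w b → InGate c′ b w′ → ⊥
  gates-disjoint {w = w} {w′} {b} (cw , v , s) (cw′ , v′ , s′) with w ≟ w′
  ... | yes refl = E-asym (InC⇒E cw) (InC⇒E cw′)
  ... | no w≢w′ with succ w≢r
    where
    out : Sep w′ r w
    out y = s′ (walk-∷ʳ y (InC⇒E cw) (E⇒≢ (InC⇒E cw′)))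
    w≢r : w ≢ r
    w≢r refl = out (stop w≢w′)
  ...   | t , e , u = s (subst (λ t → Av w t r) t≡b u)
    where
    out : Sep w′ r w
    out y = s′ (walk-∷ʳ y (InC⇒E cw) (E⇒≢ (InC⇒E cw′)))
    t≡b : t ≡ b
    t≡b = out-unique e (InC⇒E cw)
      (walk-++ u (av-init out w≢w′))
      (av-edge (E⇒≢ (InC⇒E cw) ∘ sym) (InC⇒E cw′) (w≢w′ ∘ sym))

  -- Mark b (inj₁ c), resp. Mark b (inj₂ c): on the cycle c, b follows, resp. precedes, the vertex
  -- nearest to r.
  Mark : Fin n → Fin q ⊎ Fin q → Set
  Mark b (inj₁ c) = ∃ λ w → OutGate c w b
  Mark b (inj₂ c) = ∃ λ w → InGate c b w

  mark-unique : ∀ {b b′} l → Mark b l → Mark b′ l → b ≡ b′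
  mark-unique (inj₁ _) (_ , g) (_ , g′) = out-gate-unique g g′
  mark-unique (inj₂ _) (_ , g) (_ , g′) = in-gate-unique g g′

  out-mark : ∀ {w b} → E w b → Av b r w → Sep w b r → ∃ λ c → Mark b (inj₁ c)
  out-mark e v s with cycle-of e
  ... | c , cw = c , _ , cw , v , s

  in-mark : ∀ {w b} → E b w → Av b w r → Sep w r b → ∃ λ c → Mark b (inj₂ c)
  in-mark e v s with cycle-of e
  ... | c , cw = c , _ , cw , v , s

  classify-arc : ∀ b → b ≢ r → (∃ λ c → Mark b (inj₁ c)) ⊎ ∃ λ a → Good r a b
  classify-arc b b≢r with pred (b≢r ∘ sym)
  ... | a , e , w with av? a b r
  ...   | inj₁ v = inj₂ (a , e , v , w)
  ...   | inj₂ s = inj₁ (out-mark e w s)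

  classify-vertex : ∀ u → u ≢ r → (∃ λ l → Mark u l) ⊎ ∃₂ λ a b → Generic r a u u b
  classify-vertex u u≢r with classify-arc u u≢r
  ... | inj₁ (c , m) = inj₁ (inj₁ c , m)
  ... | inj₂ (a , g) with succ u≢r
  ...   | b , e , w with av? b r u
  ...     | inj₁ v = inj₂ (a , b , g , (e , w , v) , vertex)
  ...     | inj₂ s with in-mark e w s
  ...       | c , m = inj₁ (inj₂ c , m)

-- Counting by injective codes

finite-≤ : ∀ {A B : Set} {a b} → Fin a ↔ A → Fin b ↔ B →
           {f : A → B} → Injective _≡_ _≡_ f → a ≤ b
finite-≤ i j {f} f-inj = injective⇒≤ {f = from j ∘ f ∘ to i}
  (λ eq → injective i (f-inj (injective (↔-sym j) eq)))
  where
  open Inverse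
  injective : ∀ {A B : Set} (i : A ↔ B) → Injective _≡_ _≡_ (to i)
  injective i {x} {y} eq = trans (sym (strictlyInverseʳ i x))
                                 (trans (cong (from i) eq) (strictlyInverseʳ i y))

-- Codes are given as relations, so that injectivity is proved by matching on two codes with the
-- same value instead of unfolding the choices made in the function.
function : ∀ {A B : Set} (R : A → B → Set) → (∀ x → ∃ (R x)) →
           (∀ {x y z} → R x z → R y z → x ≡ y) →
           ∃ λ (f : A → B) → Injective _≡_ _≡_ f
function R total unique = (λ x → proj₁ (total x)) ,
  λ {x} {y} eq → unique (subst (R x) eq (proj₂ (total x))) (proj₂ (total y))

infixr 4 _⊕_

_⊕_ : ∀ {A B : Set} {a b} → Fin a ↔ A → Fin b ↔ B → Fin (a + b) ↔ (A ⊎ B)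
i ⊕ j = (i ⊎-↔ j) ↔-∘ +↔⊎

-- The t vertices kept stay in the clique although they are marked.
record Clique (C : Cactus n q) (r : Fin n) (t : ℕ) : Set₁ where
  open Clashes C
  open Gates C r
  field
    Member : Element n → Set
    clash : ∀ {e f} → Member e → Member f → e ≢ f → Clash e f
    kept : Fin t → Fin n
    kept-injective : Injective _≡_ _≡_ kept
    kept-marked : ∀ s → ∃ λ l → Mark (kept s) l
    member-vertex : ∀ u → Member (vert u) ⊎ ∃ λ l → Mark u l × (∀ s → u ≢ kept s)
    keptₐ : Fin n
    keptₐ-marked : ∃ λ c → Mark keptₐ (inj₁ c)
    -- Arcs are counted by their heads, and only successors of gates lose their arc.
    member-arc : ∀ b → (∃ λ a → Member (arrow a b)) ⊎ ∃ λ c → Mark b (inj₁ c) × b ≢ keptₐ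

module Counting {C : Cactus n q} {r : Fin n} {t : ℕ} (K : Clique C r t) where
  open Clashes C
  open Gates C r
  open Clique K

  private
    kept-clash : ∀ {s s′ l} → Mark (kept s) l → Mark (kept s′) l → s ≡ s′
    kept-clash m m′ = kept-injective (mark-unique _ m m′)

  module _ {k} (col : Fin n → Fin k)
           (proper : ∀ {u v} → Clash (vert u) (vert v) → u ≢ v → col u ≢ col v) where

    private
      -- A member is coded by its colour and a discarded vertex by its mark. The kept vertices are
      -- members, so their marks are still free to code the t additional points.
      data Code : Fin n ⊎ Fin t → Fin k ⊎ (Fin q ⊎ Fin q) → Set where
        coloured : ∀ {u c} → Member (vert u) → col u ≡ c → Code (inj₁ u) (inj₁ c)
        marked : ∀ {u l} → Mark u l → (∀ s → u ≢ kept s) → Code (inj₁ u) (inj₂ l)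
        extra : ∀ {s l} → Mark (kept s) l → Code (inj₂ s) (inj₂ l)

      total : ∀ x → ∃ (Code x)
      total (inj₁ u) with member-vertex u
      ... | inj₁ m = _ , coloured m refl
      ... | inj₂ (l , m , new) = _ , marked m new
      total (inj₂ s) = _ , extra (proj₂ (kept-marked s))

      unique : ∀ {x y z} → Code x z → Code y z → x ≡ y
      unique {inj₁ u} {inj₁ v} (coloured m eq) (coloured m′ eq′) with u ≟ v
      ... | yes refl = refl
      ... | no u≢v = contradiction (trans eq (sym eq′))
              (proper (clash m m′ (λ { refl → u≢v refl })) u≢v)
      unique (marked m _) (marked m′ _) = cong inj₁ (mark-unique _ m m′)
      unique (marked m new) (extra m′) = contradiction (mark-unique _ m m′) (new _)
      unique (extra m) (marked m′ new) = contradiction (mark-unique _ m′ m) (new _)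
      unique (extra m) (extra m′) = cong inj₂ (kept-clash m m′)

    vertex-bound : n + t ≤ k + (q + q)
    vertex-bound = finite-≤ (↔-id _ ⊕ ↔-id _) (↔-id _ ⊕ ↔-id _ ⊕ ↔-id _)
                            (proj₂ (function Code total unique))

  module _ {k} (col : Element n → Fin k)
           (proper : ∀ {e f} → Clash e f → e ≢ f → col e ≢ col f) where

    private
      data Code : (Fin n ⊎ Fin n) ⊎ (Fin t ⊎ Fin 1) →
                  Fin k ⊎ ((Fin q ⊎ Fin q) ⊎ Fin q) → Set where
        coloured : ∀ {u c} → Member (vert u) → col (vert u) ≡ c →
                   Code (inj₁ (inj₁ u)) (inj₁ c)
        marked : ∀ {u l} → Mark u l → (∀ s → u ≢ kept s) →
                 Code (inj₁ (inj₁ u)) (inj₂ (inj₁ l))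
        extra : ∀ {s l} → Mark (kept s) l → Code (inj₂ (inj₁ s)) (inj₂ (inj₁ l))
        colouredₐ : ∀ {a b c} → Member (arrow a b) → col (arrow a b) ≡ c →
                    Code (inj₁ (inj₂ b)) (inj₁ c)
        markedₐ : ∀ {b c} → Mark b (inj₁ c) → b ≢ keptₐ →
                  Code (inj₁ (inj₂ b)) (inj₂ (inj₂ c))
        extraₐ : ∀ {c} → Mark keptₐ (inj₁ c) → Code (inj₂ (inj₂ zero)) (inj₂ (inj₂ c))

      total : ∀ x → ∃ (Code x)
      total (inj₁ (inj₁ u)) with member-vertex u
      ... | inj₁ m = _ , coloured m refl
      ... | inj₂ (l , m , new) = _ , marked m new
      total (inj₁ (inj₂ b)) with member-arc b
      ... | inj₁ (a , m) = _ , colouredₐ m refl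
      ... | inj₂ (l , m , new) = _ , markedₐ m new
      total (inj₂ (inj₁ s)) = _ , extra (proj₂ (kept-marked s))
      total (inj₂ (inj₂ zero)) = _ , extraₐ (proj₂ keptₐ-marked)

      differ : ∀ {e f} {A : Set} → Member e → Member f → e ≢ f → col e ≡ col f → A
      differ m m′ e≢f eq = contradiction eq (proper (clash m m′ e≢f) e≢f)

      unique : ∀ {x y z} → Code x z → Code y z → x ≡ y
      unique {inj₁ (inj₁ u)} {inj₁ (inj₁ v)} (coloured m eq) (coloured m′ eq′) with u ≟ v
      ... | yes refl = refl
      ... | no u≢v = differ m m′ (λ { refl → u≢v refl }) (trans eq (sym eq′))
      unique (coloured m eq) (colouredₐ m′ eq′) = differ m m′ (λ ()) (trans eq (sym eq′))
      unique (colouredₐ m eq) (coloured m′ eq′) = differ m m′ (λ ()) (trans eq (sym eq′))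
      unique {inj₁ (inj₂ b)} {inj₁ (inj₂ d)} (colouredₐ m eq) (colouredₐ m′ eq′) with b ≟ d
      ... | yes refl = refl
      ... | no b≢d = differ m m′ (λ { refl → b≢d refl }) (trans eq (sym eq′))
      unique (marked m _) (marked m′ _) = cong (inj₁ ∘ inj₁) (mark-unique _ m m′)
      unique (marked m new) (extra m′) = contradiction (mark-unique _ m m′) (new _)
      unique (extra m) (marked m′ new) = contradiction (mark-unique _ m′ m) (new _)
      unique (extra m) (extra m′) = cong (inj₂ ∘ inj₁) (kept-clash m m′)
      unique (markedₐ m _) (markedₐ m′ _) = cong (inj₁ ∘ inj₂) (mark-unique (inj₁ _) m m′)
      unique (markedₐ m new) (extraₐ m′) = contradiction (mark-unique (inj₁ _) m m′) new
      unique (extraₐ m) (markedₐ m′ new) = contradiction (mark-unique (inj₁ _) m′ m) new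
      unique (extraₐ _) (extraₐ _) = refl

    total-bound : (n + n) + (t + 1) ≤ k + ((q + q) + q)
    total-bound = finite-≤ ((↔-id _ ⊕ ↔-id _) ⊕ ↔-id _ ⊕ ↔-id _)
                           (↔-id _ ⊕ (↔-id _ ⊕ ↔-id _) ⊕ ↔-id _)
                           (proj₂ (function Code total unique))

-- The basic clique and the clique with one more kept vertex

module _ (C : Cactus n q) {r o i : Fin n} (ro : Cactus.E C r o) (ir : Cactus.E C i r)
         (oi : Avoiding (Cactus.E C) o r i) where
  open Betweenness C
  open Clashes C
  open Gates C r
  open Special C ro ir oi

  out-kept-marked : ∃ λ c → Mark o (inj₁ c)
  out-kept-marked = out-mark ro (stop (E⇒≢ ro)) sep-right

  in-kept-marked : ∃ λ c → Mark i (inj₂ c)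
  in-kept-marked = in-mark ir (stop (E⇒≢ ir ∘ sym)) sep-left

  basic-clique : Clique C r 2
  basic-clique = record
    { Member = Member ; clash = clash ; kept = kept ; kept-injective = kept-injective
    ; kept-marked = kept-marked ; member-vertex = member-vertex
    ; keptₐ = o ; keptₐ-marked = out-kept-marked ; member-arc = member-arc }
    where
    Member : Element n → Set
    Member e = Core e ⊎ ∃₂ λ α β → ∃₂ λ γ δ → GenericElement e α β γ δ
    clash : ∀ {e f} → Member e → Member f → e ≢ f → Clash e f
    clash (inj₁ c) (inj₁ d) e≢f = core-clash c d e≢f
    clash (inj₁ c) (inj₂ (_ , _ , _ , _ , g)) _ = clash-sym (generic-core-clash g c)
    clash (inj₂ (_ , _ , _ , _ , g)) (inj₁ c) _ = generic-core-clash g c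
    clash (inj₂ (_ , _ , _ , _ , g)) (inj₂ (_ , _ , _ , _ , h)) = generic-generic-clash g h
    kept : Fin 2 → Fin n
    kept zero = o
    kept (suc zero) = i
    kept-injective : Injective _≡_ _≡_ kept
    kept-injective {zero} {zero} _ = refl
    kept-injective {zero} {suc zero} eq = contradiction (sym eq) (walk-target oi)
    kept-injective {suc zero} {zero} eq = contradiction eq (walk-target oi)
    kept-injective {suc zero} {suc zero} _ = refl
    kept-marked : ∀ s → ∃ λ l → Mark (kept s) l
    kept-marked zero = inj₁ _ , proj₂ out-kept-marked
    kept-marked (suc zero) = inj₂ _ , proj₂ in-kept-marked
    member-vertex : ∀ u → Member (vert u) ⊎ ∃ λ l → Mark u l × (∀ s → u ≢ kept s)
    member-vertex u with u ≟ r | u ≟ o | u ≟ i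
    ... | yes refl | _ | _ = inj₁ (inj₁ root)
    ... | _ | yes refl | _ = inj₁ (inj₁ (out vert))
    ... | _ | _ | yes refl = inj₁ (inj₁ (inn vert))
    ... | no u≢r | no u≢o | no u≢i with classify-vertex u u≢r
    ...   | inj₁ (l , m) = inj₂ (l , m , λ { zero → u≢o ; (suc zero) → u≢i })
    ...   | inj₂ (_ , _ , g) = inj₁ (inj₂ (_ , _ , _ , _ , vert g))
    member-arc : ∀ b → (∃ λ a → Member (arrow a b)) ⊎ ∃ λ c → Mark b (inj₁ c) × b ≢ o
    member-arc b with b ≟ r | b ≟ o
    -- No path from r has a last arc with head r, so this head is used for i → r.
    ... | yes refl | _ = inj₁ (i , inj₁ (inn arrow))
    ... | _ | yes refl = inj₁ (r , inj₁ (out arrow))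
    ... | no b≢r | no b≢o with classify-arc b b≢r
    ...   | inj₁ (c , m) = inj₂ (c , m , b≢o)
    ...   | inj₂ (a , g) = inj₁ (a , inj₂ (_ , _ , _ , _ , arrow (g , g , arc)))

module _ (C : Cactus n q) {r o i x v j : Fin n}
         (ro : Cactus.E C r o) (ir : Cactus.E C i r)
         (rx : Cactus.E C r x) (o≢x : o ≢ x) (xv : Avoiding (Cactus.E C) r x v)
         (vi : Avoiding (Cactus.E C) r v i)
         (jv : Cactus.E C j v) (vj : ¬ Avoiding (Cactus.E C) v r j)
         (short : ∀ {z} → ¬ Avoiding (Cactus.E C) z r v → z ≡ r ⊎ z ≡ x ⊎ z ≡ v)
         (thin : x ≡ v ⊎ (∀ b → Cactus.E C x b → b ≡ v)) where
  open Betweenness C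
  open Clashes C
  open Gates C r
  open Extra C ro ir rx o≢x xv vi jv vj

  -- `short` and `thin` provide the hypothesis of `generic-extra-clash`. Between r and v only x
  -- could violate it; but x, being a successor of r, is not a generic vertex, and the only arc from
  -- x is the one into v, which j → v replaces.
  extended-clique : Clique C r 3
  extended-clique = record
    { Member = Member ; clash = clash ; kept = kept ; kept-injective = kept-injective
    ; kept-marked = kept-marked ; member-vertex = member-vertex
    ; keptₐ = o ; keptₐ-marked = out-kept-marked C ro ir oi ; member-arc = member-arc }
    where
    Member : Element n → Set
    Member e = Core e ⊎ ExtraEnd e ⊎
               ∃₂ λ α β → ∃₂ λ γ δ → GenericElement e α β γ δ × (Sep γ r v → γ ≡ v)
    clash : ∀ {e f} → Member e → Member f → e ≢ f → Clash e f
    clash (inj₁ c) (inj₁ d) e≢f = core-clash c d e≢f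
    clash (inj₁ c) (inj₂ (inj₁ d)) _ = clash-sym (extra-core-clash d c)
    clash (inj₁ c) (inj₂ (inj₂ (_ , _ , _ , _ , g , _))) _ = clash-sym (generic-core-clash g c)
    clash (inj₂ (inj₁ c)) (inj₁ d) _ = extra-core-clash c d
    clash (inj₂ (inj₁ c)) (inj₂ (inj₁ d)) e≢f = extra-extra-clash c d e≢f
    clash (inj₂ (inj₁ c)) (inj₂ (inj₂ (_ , _ , _ , _ , g , near))) _ =
      clash-sym (generic-extra-clash g near c)
    clash (inj₂ (inj₂ (_ , _ , _ , _ , g , _))) (inj₁ c) _ = generic-core-clash g c
    clash (inj₂ (inj₂ (_ , _ , _ , _ , g , near))) (inj₂ (inj₁ c)) _ =
      generic-extra-clash g near c
    clash (inj₂ (inj₂ (_ , _ , _ , _ , g , _))) (inj₂ (inj₂ (_ , _ , _ , _ , h , _))) =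
      generic-generic-clash g h
    kept : Fin 3 → Fin n
    kept zero = o
    kept (suc zero) = i
    kept (suc (suc zero)) = j
    i≢o : i ≢ o
    i≢o = walk-target oi
    i≢j : i ≢ j
    i≢j refl = r≢v (out-unique ir jv (stop r≢j) j-return)
    o≢j : o ≢ j
    o≢j refl = o≢x (out-unique ro rx (stop (r≢j ∘ sym)) (walk-++ xv (av-tail vj r≢v)))
    kept-injective : Injective _≡_ _≡_ kept
    kept-injective {zero} {zero} _ = refl
    kept-injective {zero} {suc zero} eq = contradiction (sym eq) i≢o
    kept-injective {zero} {suc (suc zero)} eq = contradiction eq o≢j
    kept-injective {suc zero} {zero} eq = contradiction eq i≢o
    kept-injective {suc zero} {suc zero} _ = refl
    kept-injective {suc zero} {suc (suc zero)} eq = contradiction eq i≢j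
    kept-injective {suc (suc zero)} {zero} eq = contradiction (sym eq) o≢j
    kept-injective {suc (suc zero)} {suc zero} eq = contradiction (sym eq) i≢j
    kept-injective {suc (suc zero)} {suc (suc zero)} _ = refl
    kept-marked : ∀ s → ∃ λ l → Mark (kept s) l
    kept-marked zero = inj₁ _ , proj₂ (out-kept-marked C ro ir oi)
    kept-marked (suc zero) = inj₂ _ , proj₂ (in-kept-marked C ro ir oi)
    kept-marked (suc (suc zero)) = inj₂ _ , proj₂ (in-mark jv j-return vj)
    near-vertex : ∀ {a u b} → u ≢ r → Generic r a u u b → Sep u r v → u ≡ v
    near-vertex u≢r ((e , w , w′) , _) s with short s
    ... | inj₁ u≡r = contradiction u≡r u≢r
    ... | inj₂ (inj₂ u≡v) = u≡v
    ... | inj₂ (inj₁ refl) =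
      contradiction (in-unique rx e (stop (E⇒≢ rx)) w′) (walk-target w)
    near-arc : ∀ {a b} → b ≢ v → Good r a b → Sep a r v → a ≡ v
    near-arc b≢v (e , w , _) s with short s
    ... | inj₁ refl = contradiction refl (walk-target w)
    ... | inj₂ (inj₂ a≡v) = a≡v
    ... | inj₂ (inj₁ refl) = [ id , (λ only → contradiction (only _ e) b≢v) ]′ thin
    member-vertex : ∀ u → Member (vert u) ⊎ ∃ λ l → Mark u l × (∀ s → u ≢ kept s)
    member-vertex u with u ≟ r | u ≟ o | u ≟ i | u ≟ j
    ... | yes refl | _ | _ | _ = inj₁ (inj₁ root)
    ... | _ | yes refl | _ | _ = inj₁ (inj₁ (out vert))
    ... | _ | _ | yes refl | _ = inj₁ (inj₁ (inn vert))
    ... | _ | _ | _ | yes refl = inj₁ (inj₂ (inj₁ vert))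
    ... | no u≢r | no u≢o | no u≢i | no u≢j with classify-vertex u u≢r
    ...   | inj₁ (l , m) =
            inj₂ (l , m , λ { zero → u≢o ; (suc zero) → u≢i ; (suc (suc zero)) → u≢j })
    ...   | inj₂ (_ , _ , g) =
            inj₁ (inj₂ (inj₂ (_ , _ , _ , _ , vert g , near-vertex u≢r g)))
    member-arc : ∀ b → (∃ λ a → Member (arrow a b)) ⊎ ∃ λ c → Mark b (inj₁ c) × b ≢ o
    member-arc b with b ≟ r | b ≟ o | b ≟ v
    ... | yes refl | _ | _ = inj₁ (i , inj₁ (inn arrow))
    ... | _ | yes refl | _ = inj₁ (r , inj₁ (out arrow))
    ... | _ | _ | yes refl = inj₁ (j , inj₂ (inj₁ arrow))
    ... | no b≢r | no b≢o | no b≢v with classify-arc b b≢r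
    ...   | inj₁ (c , m) = inj₂ (c , m , b≢o)
    ...   | inj₂ (a , g) =
            inj₁ (a , inj₂ (inj₂ (_ , _ , _ , _ , arrow (g , g , arc) , near-arc b≢v g)))

-- Cut-vertices as branching vertices

module Cuts₁ (C : Cactus n q) where
  open Betweenness C

  -- Directed and decidable forms of being a cut-vertex; `out-cut⇒cut-vertex` and
  -- `cut-vertex⇒out-cut` give the equivalence for `OutCut`.
  OutCut InCut : Fin n → Set
  OutCut v = ∃₂ λ a b → a ≢ b × E v a × E v b
  InCut v = ∃₂ λ a b → a ≢ b × E a v × E b v

  -- Each arc out of v is continued to the last arc on the way back to v; by `out-unique`, equal
  -- last arcs would force equal first arcs.
  out-cut⇒in-cut : ∀ {v} → OutCut v → InCut v
  out-cut⇒in-cut (a , b , a≢b , va , vb) with pred (E⇒≢ va ∘ sym) | pred (E⇒≢ vb ∘ sym)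
  ... | s , sv , as | t , tv , bt =
    s , t , (λ { refl → a≢b (out-unique va vb as bt) }) , sv , tv

module Cuts (C : Cactus n q) where
  open Betweenness C
  open Cuts₁ C public

  in-cut⇒out-cut : ∀ {v} → InCut v → OutCut v
  in-cut⇒out-cut = Cuts₁.out-cut⇒in-cut (reverse-cactus C)

  out-cut? : ∀ v → Dec (OutCut v)
  out-cut? v = any? λ a → any? λ b → ¬? (a ≟ b) ×-dec E? v a ×-dec E? v b

  cycle-next : ∀ {c a b} → InC c a b → ∃ λ d → InC c b d
  cycle-next cab with cycle-connected cab cab
  ... | stop _ = _ , cab
  ... | step _ cbd _ = _ , cbd

  -- Without a branching vertex a walk that starts on the cycle c never leaves it, so it could not
  -- reach an arc of d.
  cut-exists : ∀ {c d : Fin q} → c ≢ d → ∃ OutCut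
  cut-exists {c} {d} c≢d with any? out-cut?
  ... | yes found = found
  ... | no none with cycle-arc c | cycle-arc d
  ...   | _ , b , cab | a′ , b′ , cab′ with follow (cycle-next cab) (connected b a′)
    where
    follow : ∀ {P : Fin n → Set} {x z} → (∃ λ y → InC c x y) → Walk E P x z → ∃ λ y → InC c z y
    follow on (stop _) = on
    follow {x = x} (y , cxy) (step {y = y′} _ e w) with y ≟ y′
    ... | yes refl = follow (cycle-next cxy) w
    ... | no y≢y′ = contradiction (x , y , y′ , y≢y′ , InC⇒E cxy , e) none
  ...     | y , ca′y with y ≟ b′
  ...       | yes refl = contradiction (cycle-unique ca′y cab′) c≢d
  ...       | no y≢b′ = contradiction (a′ , y , b′ , y≢b′ , InC⇒E ca′y , InC⇒E cab′) none

  cut-clique : ∀ {r} → OutCut r → Clique C r 2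
  -- The predecessor i of r is taken on the way back from the other successor b, hence on another
  -- cycle than r → o.
  cut-clique {r} (o , b , o≢b , ro , rb) with pred (E⇒≢ rb ∘ sym)
  ... | i , ir , bi = basic-clique C ro ir oi
    where
    oi : Av o r i
    oi with av? o r i
    ... | inj₁ w = w
    ... | inj₂ s = contradiction (out-unique ro rb (av-tail s (E⇒≢ ro)) bi) o≢b

  private
    -- The choices are: o is a successor of r off the path to v, i is the predecessor of r on the
    -- path from v, and j is a predecessor of v that r reaches only through v. Such a j exists
    -- because two predecessors reached without v would coincide.
    close-clique : ∀ {r x v} → OutCut r → OutCut v → v ≢ r → E r x → Av r x v →
                   (∀ {z} → Sep z r v → z ≡ r ⊎ z ≡ x ⊎ z ≡ v) →
                   x ≡ v ⊎ (∀ b → E x b → b ≡ v) → Clique C r 3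
    close-clique {r} {x} {v} cut-r cut-v v≢r rx xv short thin
      with other cut-r | pred v≢r | other-in (out-cut⇒in-cut cut-v)
      where
      other : OutCut r → ∃ λ o → E r o × o ≢ x
      other (a , b , a≢b , ra , rb) with a ≟ x
      ... | no a≢x = a , ra , a≢x
      ... | yes refl = b , rb , a≢b ∘ sym
      other-in : InCut v → ∃ λ j → E j v × Sep v r j
      other-in (a , b , a≢b , av , bv) with av? v r a | av? v r b
      ... | inj₂ s | _ = a , av , s
      ... | inj₁ _ | inj₂ s = b , bv , s
      ... | inj₁ u | inj₁ w = contradiction (in-unique av bv u w) a≢b
    ... | o , ro , o≢x | i , ir , vi | j , jv , vj =
      extended-clique C ro ir rx o≢x xv vi jv vj short thin

    adjacent-clique : ∀ {r v} → OutCut r → OutCut v → E r v → Clique C r 3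
    adjacent-clique {r} {v} cut-r cut-v rv =
      close-clique cut-r cut-v v≢r rv (stop v≢r) short (inj₁ refl)
      where
      v≢r = E⇒≢ rv ∘ sym
      short : ∀ {z} → Sep z r v → z ≡ r ⊎ z ≡ v ⊎ z ≡ v
      short {z} s with z ≟ r | z ≟ v
      ... | yes z≡r | _ = inj₁ z≡r
      ... | no _ | yes z≡v = inj₂ (inj₁ z≡v)
      ... | no z≢r | no z≢v = contradiction (av-edge (z≢r ∘ sym) rv (z≢v ∘ sym)) s

  -- If the middle vertex x branches, r and x are already adjacent cut-vertices; otherwise v is its
  -- only successor.
  near-cuts-clique : ∀ {r v} → OutCut r → OutCut v → r ≢ v →
                     E r v ⊎ (∃ λ x → E r x × E x v) → Clique C r 3
  near-cuts-clique cut-r cut-v _ (inj₁ rv) = adjacent-clique cut-r cut-v rv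
  near-cuts-clique {r} {v} cut-r cut-v r≢v (inj₂ (x , rx , xv)) with out-cut? x
  ... | yes cut-x = adjacent-clique cut-r cut-x rx
  ... | no ¬cut-x = close-clique cut-r cut-v (r≢v ∘ sym) rx
                      (av-edge (E⇒≢ rx ∘ sym) xv (r≢v ∘ sym)) short (inj₂ thin)
    where
    short : ∀ {z} → Sep z r v → z ≡ r ⊎ z ≡ x ⊎ z ≡ v
    short {z} s with z ≟ r | z ≟ x | z ≟ v
    ... | yes z≡r | _ | _ = inj₁ z≡r
    ... | _ | yes z≡x | _ = inj₂ (inj₁ z≡x)
    ... | _ | _ | yes z≡v = inj₂ (inj₂ z≡v)
    ... | no z≢r | no z≢x | no z≢v =
      contradiction (step (z≢r ∘ sym) rx (av-edge (z≢x ∘ sym) xv (z≢v ∘ sym))) s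
    thin : ∀ b → E x b → b ≡ v
    thin b xb with b ≟ v
    ... | yes b≡v = b≡v
    ... | no b≢v = contradiction (b , v , b≢v , xb , xv) ¬cut-x

  Far : Set
  Far = ∀ {u v} → OutCut u → OutCut v → u ≢ v → ¬ (E u v ⊎ (∃ λ x → E u x × E x v))

-- Colour classes when the cut-vertices are far apart

enumerate : ∀ {P : Fin n → Set} → (∀ v → Dec (P v)) →
            ∃ λ m → ∃ λ (e : Fin m → Fin n) →
              Injective _≡_ _≡_ e × (∀ k → P (e k)) × (∀ {v} → P v → ∃ λ k → e k ≡ v)
enumerate {n} {P} P? = length l , lookup l , injective (Unique.filter⁺ P? (Unique.allFin⁺ n)) ,
  (λ k → proj₂ (∈-filter⁻ P? {xs = allFin n} (∈-lookup k))) ,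
  λ p → let v∈l = ∈-filter⁺ P? (∈-allFin _) p in index v∈l , sym (lookup-index v∈l)
  where
  l = filter P? (allFin n)
  injective : ∀ {xs : List (Fin n)} → Unique xs → Injective _≡_ _≡_ (lookup xs)
  injective (_ ∷ _) {zero} {zero} _ = refl
  injective (x∉ ∷ u) {zero} {suc j} eq = contradiction eq (All.lookup x∉ (∈-lookup j))
  injective (x∉ ∷ u) {suc i} {zero} eq = contradiction (sym eq) (All.lookup x∉ (∈-lookup i))
  injective (x∉ ∷ u) {suc i} {suc j} eq = cong suc (injective u eq)

module Twins₁ (C : Cactus n q) (far : Cuts.Far C) {r : Fin n} (cut-r : Cuts.OutCut C r) where
  open Betweenness C
  open Cuts C
  open Gates C r

  Outer Inner : Fin n → Set
  Outer b = ∃₂ λ c w → OutGate c w b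
  Inner b = ∃₂ λ c w → InGate c b w

  -- A second arc into b would make b a cut-vertex adjacent to w.
  single-entry : ∀ {w b t} → OutCut w → E w b → E t b → t ≡ w
  single-entry {w} {b} {t} cut-w wb tb with t ≟ w
  ... | yes t≡w = t≡w
  ... | no t≢w = contradiction (inj₁ wb)
          (far cut-w (in-cut⇒out-cut (t , w , t≢w , tb , wb)) (E⇒≢ wb))

  outer? : ∀ b → Dec (Outer b)
  outer? b with b ≟ r
  ... | yes refl = no λ { (_ , _ , _ , v , _) → walk-source v refl }
  ... | no b≢r with classify-arc b b≢r
  ...   | inj₁ (c , w , g) = yes (c , w , g)
  ...   | inj₂ (a , e , v , v′) = no λ { (_ , _ , cw , u , s) →
            s (subst (λ a → Av a b r) (in-unique e (InC⇒E cw) v′ u) v) }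

  -- The successor of a gate w ≢ r on the cycle of w towards r represents all successors of w.
  out-twin : ∀ {c w b} → OutGate c w b → w ≢ r →
             ∃ λ s → E w s × OutCut w × ¬ Outer s × ¬ Inner s
  out-twin {c} {w} {b} (cw , v , sep) w≢r with succ w≢r
  ... | s , ws , u = s , ws , cut-w , not-outer , not-inner
    where
    cut-w : OutCut w
    cut-w = b , s , (λ { refl → sep u }) , InC⇒E cw , ws
    not-outer : ¬ Outer s
    not-outer (_ , w′ , cw′ , _ , sep′) with single-entry cut-w ws (InC⇒E cw′)
    ... | refl = sep′ u
    not-inner : ¬ Inner s
    -- If s preceded a gate g, then w → s → g would join two cut-vertices: g is r, or besides s it
    -- has the predecessor on the path from r.
    not-inner (_ , g , cg , _ , sep′) with g ≟ r
    ... | yes refl = far cut-w cut-r w≢r (inj₂ (s , ws , InC⇒E cg))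
    ... | no g≢r with pred (g≢r ∘ sym)
    ...   | t , tg , y = far cut-w
            (in-cut⇒out-cut (t , s , (λ { refl → sep′ y }) , tg , InC⇒E cg))
            (λ { refl → E-asym ws (InC⇒E cg) }) (inj₂ (s , ws , InC⇒E cg))

module Twins (C : Cactus n q) (far : Cuts.Far C) {r o i : Fin n} (cut-r : Cuts.OutCut C r)
             (ro : Cactus.E C r o) (ir : Cactus.E C i r) where
  open Betweenness C
  open Cuts C
  open Gates C r
  open Twins₁ C far cut-r public
  private
    rev-far : Cuts.Far (reverse-cactus C)
    rev-far u v u≢v (inj₁ e) = far (in-cut⇒out-cut v) (in-cut⇒out-cut u) (u≢v ∘ sym) (inj₁ e)
    rev-far u v u≢v (inj₂ (x , e , f)) =
      far (in-cut⇒out-cut v) (in-cut⇒out-cut u) (u≢v ∘ sym) (inj₂ (x , f , e))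

    module Rev = Twins₁ (reverse-cactus C) rev-far (out-cut⇒in-cut cut-r)

    to-outer : ∀ {b} → Inner b → Rev.Outer b
    to-outer (c , w , cw , v , s) = c , w , cw , walk-reverse v , s ∘ walk-reverse

    from-outer : ∀ {b} → Rev.Outer b → Inner b
    from-outer (c , w , cw , v , s) = c , w , cw , walk-reverse v , s ∘ walk-reverse

    to-inner : ∀ {b} → Outer b → Rev.Inner b
    to-inner (c , w , cw , v , s) = c , w , cw , walk-reverse v , s ∘ walk-reverse

  single-exit : ∀ {w b t} → OutCut w → E b w → E b t → t ≡ w
  single-exit cut-w = Rev.single-entry (out-cut⇒in-cut cut-w)

  inner? : ∀ b → Dec (Inner b)
  inner? b with Rev.outer? b
  ... | yes p = yes (from-outer p)
  ... | no ¬p = no (¬p ∘ to-outer)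

  in-twin : ∀ {b} ((c , w , _) : Inner b) → w ≢ r →
            ∃ λ s → E s w × OutCut w × ¬ Outer s × ¬ Inner s
  in-twin x w≢r with Rev.out-twin (proj₂ (proj₂ (to-outer x))) w≢r
  ... | s , sw , cut-w , p , p′ = s , sw , in-cut⇒out-cut cut-w , p′ ∘ to-inner , p ∘ to-outer

  disjoint : ∀ {b} → Outer b → Inner b → ⊥
  disjoint (_ , _ , g) (_ , _ , g′) = gates-disjoint g g′

  outer-o : Outer o
  outer-o with cycle-of ro
  ... | c , cro = c , r , cro , stop (E⇒≢ ro) , sep-right

  inner-i : Inner i
  inner-i with cycle-of ir
  ... | c , cir = c , r , cir , stop (E⇒≢ ir ∘ sym) , sep-left

  -- The colours are indexed by these vertices: the unmarked ones, together with o and i, which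
  -- represent the successors and the predecessors of r.
  Keptₐ Kept : Fin n → Set
  Keptₐ b = Outer b → b ≡ o
  Kept b = Keptₐ b × (Inner b → b ≡ i)

  keptₐ? : ∀ b → Dec (Keptₐ b)
  keptₐ? b = outer? b →-dec b ≟ o

  kept? : ∀ b → Dec (Kept b)
  kept? b = keptₐ? b ×-dec (inner? b →-dec b ≟ i)

  out-rep : ∀ {c w b} → OutGate c w b → b ≢ o → ∃ λ s → E w s × OutCut w × Kept s
  out-rep {w = w} g b≢o with w ≟ r
  ... | yes refl = o , ro , cut-r , (λ _ → refl) , λ p → contradiction p (disjoint outer-o)
  ... | no w≢r with out-twin g w≢r
  ...   | s , ws , cut-w , p , p′ = s , ws , cut-w , ⊥-elim ∘ p , ⊥-elim ∘ p′

  in-rep : ∀ {b} ((c , w , _) : Inner b) → b ≢ i → ∃ λ s → E s w × OutCut w × Kept s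
  in-rep x@(_ , w , _) b≢i with w ≟ r
  ... | yes refl = i , ir , cut-r , (λ p → contradiction inner-i (disjoint p)) , λ _ → refl
  ... | no w≢r with in-twin x w≢r
  ...   | s , ws , cut-w , p , p′ = s , ws , cut-w , ⊥-elim ∘ p , ⊥-elim ∘ p′

  Twin : Fin n → Fin n → Set
  Twin u v = ∃ λ w → OutCut w × ((E w u × E w v) ⊎ (E u w × E v w))

  rep : ∀ u → ∃ λ s → Kept s × (u ≡ s ⊎ Twin u s)
  rep u with kept? u
  ... | yes p = u , p , inj₁ refl
  ... | no ¬kept with outer? u | inner? u
  ...   | yes x@(_ , w , g@(cw , _)) | _ with out-rep g u≢o
    where
    u≢o : u ≢ o
    u≢o u≡o = ¬kept ((λ _ → u≡o) , λ p → contradiction p (disjoint x))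
  ...     | s , ws , cut-w , kept = s , kept , inj₂ (w , cut-w , inj₁ (InC⇒E cw , ws))
  rep u | no ¬kept | no ¬outer | yes x@(_ , w , cw , _) with in-rep x u≢i
    where
    u≢i : u ≢ i
    u≢i u≡i = ¬kept (⊥-elim ∘ ¬outer , λ _ → u≡i)
  ... | s , sw , cut-w , kept = s , kept , inj₂ (w , cut-w , inj₂ (InC⇒E cw , sw))
  rep u | no ¬kept | no ¬outer | no ¬inner =
    contradiction (⊥-elim ∘ ¬outer , ⊥-elim ∘ ¬inner) ¬kept

  -- A common representative that follows one cut-vertex and precedes another would put them two
  -- arcs apart; in the remaining cases the two cut-vertices coincide.
  twins : ∀ {u v s} → u ≡ s ⊎ Twin u s → v ≡ s ⊎ Twin v s → u ≢ v → Twin u v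
  twins (inj₁ refl) (inj₁ refl) u≢v = contradiction refl u≢v
  twins (inj₁ refl) (inj₂ (w , c , inj₁ (e , f))) _ = w , c , inj₁ (f , e)
  twins (inj₁ refl) (inj₂ (w , c , inj₂ (e , f))) _ = w , c , inj₂ (f , e)
  twins (inj₂ t) (inj₁ refl) _ = t
  twins (inj₂ (w , c , inj₁ (e , f))) (inj₂ (w′ , c′ , inj₁ (e′ , f′))) _
    with single-entry c f f′
  ... | refl = w , c , inj₁ (e , e′)
  twins (inj₂ (w , c , inj₂ (e , f))) (inj₂ (w′ , c′ , inj₂ (e′ , f′))) _
    with single-exit c f f′
  ... | refl = w , c , inj₂ (e , e′)
  twins (inj₂ (w , c , inj₁ (_ , f))) (inj₂ (w′ , c′ , inj₂ (_ , f′))) _ =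
    contradiction (inj₂ (_ , f , f′)) (far c c′ (λ { refl → E-asym f f′ }))
  twins (inj₂ (w , c , inj₂ (_ , f))) (inj₂ (w′ , c′ , inj₁ (_ , f′))) _ =
    contradiction (inj₂ (_ , f′ , f)) (far c′ c (λ { refl → E-asym f f′ }))

  -- A discarded head follows a gate, which by `single-entry` is its only predecessor, so the arc is
  -- represented by another successor of its own tail.
  repₐ : ∀ {a b} → E a b → ∃ λ s → Keptₐ s × (b ≡ s ⊎ (E a s × OutCut a))
  repₐ {a} {b} ab with keptₐ? b
  ... | yes p = b , p , inj₁ refl
  ... | no ¬kept with outer? b
  ...   | no ¬outer = contradiction (⊥-elim ∘ ¬outer) ¬kept
  ...   | yes (_ , w , g@(cw , _)) with out-rep g (λ b≡o → ¬kept λ _ → b≡o)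
  ...     | s , ws , cut-w , kept , _ with single-entry cut-w (InC⇒E cw) ab
  ...       | refl = s , kept , inj₂ (ws , cut-w)

  twinsₐ : ∀ {a b a′ b′ s} → E a b → E a′ b′ → b ≡ s ⊎ (E a s × OutCut a) →
           b′ ≡ s ⊎ (E a′ s × OutCut a′) → a ≡ a′ ⊎ b ≡ b′
  twinsₐ _ _ (inj₁ refl) (inj₁ refl) = inj₂ refl
  twinsₐ e _ (inj₁ refl) (inj₂ (f , c)) = inj₁ (single-entry c f e)
  twinsₐ _ e′ (inj₂ (f , c)) (inj₁ refl) = inj₁ (sym (single-entry c f e′))
  twinsₐ _ _ (inj₂ (f , c)) (inj₂ (f′ , c′)) = inj₁ (single-entry c′ f′ f)

  vertex-palette : ∃ λ m → m + (q + q) ≤ n + 2 × ∃ λ (col : Fin n → Fin m) →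
                   ∀ {u v} → col u ≡ col v → u ≢ v → Twin u v
  vertex-palette with enumerate kept?
  ... | m , e , e-inj , sound , complete =
    m , finite-≤ (↔-id _ ⊕ ↔-id _ ⊕ ↔-id _) (↔-id _ ⊕ ↔-id _) (proj₂ (function Code total unique)) ,
    (λ u → proj₁ (place u)) , same
    where
    place : ∀ u → ∃ λ k → e k ≡ proj₁ (rep u)
    place u = complete (proj₁ (proj₂ (rep u)))
    same : ∀ {u v} → proj₁ (place u) ≡ proj₁ (place v) → u ≢ v → Twin u v
    same {u} {v} eq = twins (proj₂ (proj₂ (rep u)))
      (subst (λ s → v ≡ s ⊎ Twin v s)
             (trans (sym (proj₂ (place v))) (trans (cong e (sym eq)) (proj₂ (place u))))
             (proj₂ (proj₂ (rep v))))
    -- o and i are kept as well as marked, so their marks go to the two spare values.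
    data Code : Fin m ⊎ (Fin q ⊎ Fin q) → Fin n ⊎ Fin 2 → Set where
      kept : ∀ {k b} → e k ≡ b → Code (inj₁ k) (inj₁ b)
      outer : ∀ {c w b} → OutGate c w b → b ≢ o → Code (inj₂ (inj₁ c)) (inj₁ b)
      outer-root : ∀ {c w} → OutGate c w o → Code (inj₂ (inj₁ c)) (inj₂ zero)
      inner : ∀ {c w b} → InGate c b w → b ≢ i → Code (inj₂ (inj₂ c)) (inj₁ b)
      inner-root : ∀ {c w} → InGate c i w → Code (inj₂ (inj₂ c)) (inj₂ (suc zero))
    total : ∀ x → ∃ (Code x)
    total (inj₁ k) = _ , kept refl
    total (inj₂ (inj₁ c)) with out-gate-exists c
    ... | w , b , g with b ≟ o
    ...   | yes refl = _ , outer-root g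
    ...   | no b≢o = _ , outer g b≢o
    total (inj₂ (inj₂ c)) with in-gate-exists c
    ... | w , b , g with b ≟ i
    ...   | yes refl = _ , inner-root g
    ...   | no b≢i = _ , inner g b≢i
    unique : ∀ {x y z} → Code x z → Code y z → x ≡ y
    unique (kept refl) (kept eq) = cong inj₁ (e-inj (sym eq))
    unique (kept refl) (outer g b≢o) = contradiction (proj₁ (sound _) (_ , _ , g)) b≢o
    unique (kept refl) (inner g b≢i) = contradiction (proj₂ (sound _) (_ , _ , g)) b≢i
    unique (outer g b≢o) (kept refl) = contradiction (proj₁ (sound _) (_ , _ , g)) b≢o
    unique (outer g _) (outer g′ _) = cong (inj₂ ∘ inj₁) (out-gate-cycle g g′)
    unique (outer g _) (inner g′ _) = ⊥-elim (gates-disjoint g g′)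
    unique (outer-root g) (outer-root g′) = cong (inj₂ ∘ inj₁) (out-gate-cycle g g′)
    unique (inner g b≢i) (kept refl) = contradiction (proj₂ (sound _) (_ , _ , g)) b≢i
    unique (inner g _) (outer g′ _) = ⊥-elim (gates-disjoint g′ g)
    unique (inner g _) (inner g′ _) = cong (inj₂ ∘ inj₂) (in-gate-cycle g g′)
    unique (inner-root g) (inner-root g′) = cong (inj₂ ∘ inj₂) (in-gate-cycle g g′)

  arc-palette : ∃ λ m → m + q ≤ n + 1 × ∃ λ (col : Fin n → Fin n → Fin m) →
                ∀ {a b a′ b′} → E a b → E a′ b′ → col a b ≡ col a′ b′ → a ≡ a′ ⊎ b ≡ b′
  arc-palette with enumerate keptₐ?
  ... | m , e , e-inj , sound , complete =
    m , finite-≤ (↔-id _ ⊕ ↔-id _) (↔-id _ ⊕ ↔-id _) (proj₂ (function Code total unique)) ,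
    (λ a b → proj₁ (place a b)) , same
    where
    Rep : Fin n → Fin n → Fin n → Set
    Rep a b s = b ≡ s ⊎ (E a s × OutCut a)
    place : ∀ a b → ∃ λ k → E a b → Rep a b (e k)
    place a b with E? a b
    -- Pairs that are not arcs receive the colour of `o`, which always satisfies `Keptₐ`.
    ... | no ¬ab = proj₁ (complete {o} (λ _ → refl)) , λ ab → contradiction ab ¬ab
    ... | yes ab with repₐ ab
    ...   | s , p , t with complete p
    ...     | k , refl = k , λ _ → t
    same : ∀ {a b a′ b′} → E a b → E a′ b′ → proj₁ (place a b) ≡ proj₁ (place a′ b′) →
           a ≡ a′ ⊎ b ≡ b′
    same {a} {b} {a′} {b′} ab ab′ eq = twinsₐ ab ab′ (proj₂ (place a b) ab)
      (subst (Rep a′ b′) (cong e (sym eq)) (proj₂ (place a′ b′) ab′))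
    data Code : Fin m ⊎ Fin q → Fin n ⊎ Fin 1 → Set where
      kept : ∀ {k b} → e k ≡ b → Code (inj₁ k) (inj₁ b)
      outer : ∀ {c w b} → OutGate c w b → b ≢ o → Code (inj₂ c) (inj₁ b)
      outer-root : ∀ {c w} → OutGate c w o → Code (inj₂ c) (inj₂ zero)
    total : ∀ x → ∃ (Code x)
    total (inj₁ k) = _ , kept refl
    total (inj₂ c) with out-gate-exists c
    ... | w , b , g with b ≟ o
    ...   | yes refl = _ , outer-root g
    ...   | no b≢o = _ , outer g b≢o
    unique : ∀ {x y z} → Code x z → Code y z → x ≡ y
    unique (kept refl) (kept eq) = cong inj₁ (e-inj (sym eq))
    unique (kept refl) (outer g b≢o) = contradiction (sound _ (_ , _ , g)) b≢o
    unique (outer g b≢o) (kept refl) = contradiction (sound _ (_ , _ , g)) b≢o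
    unique (outer g _) (outer g′ _) = cong inj₂ (out-gate-cycle g g′)
    unique (outer-root g) (outer-root g′) = cong inj₂ (out-gate-cycle g g′)

module Size (C : Cactus n q) (r : Fin n) where
  open Gates C r

  -- Each cycle owns two marked vertices of its own. The bound makes the truncated subtractions in
  -- the theorem exact.
  two-per-cycle : q + q ≤ n
  two-per-cycle = finite-≤ (↔-id _ ⊕ ↔-id _) (↔-id _) (proj₂ (function Code total unique))
    where
    Code : Fin q ⊎ Fin q → Fin n → Set
    Code l b = Mark b l
    total : ∀ l → ∃ (Code l)
    total (inj₁ c) with out-gate-exists c
    ... | w , b , g = b , w , g
    total (inj₂ c) with in-gate-exists c
    ... | w , b , g = b , w , g
    unique : ∀ {l l′ b} → Code l b → Code l′ b → l ≡ l′
    unique {inj₁ _} {inj₁ _} (_ , g) (_ , g′) = cong inj₁ (out-gate-cycle g g′)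
    unique {inj₁ _} {inj₂ _} (_ , g) (_ , g′) = ⊥-elim (gates-disjoint g g′)
    unique {inj₂ _} {inj₁ _} (_ , g) (_ , g′) = ⊥-elim (gates-disjoint g′ g)
    unique {inj₂ _} {inj₂ _} (_ , g) (_ , g′) = cong inj₂ (in-gate-cycle g g′)

-- Consecutive pairs in lists without repetition

module _ {A : Set} where

  pair-source : ∀ (xs : List A) {z a b} → (a , b) ∈ pairs (xs ++ z ∷ []) → a ∈ xs
  pair-source (x ∷ []) (here refl) = here refl
  pair-source (x ∷ y ∷ xs) (here refl) = here refl
  pair-source (x ∷ y ∷ xs) (there p) = there (pair-source (y ∷ xs) p)

  pair-target : ∀ {x : A} ys {a b} → (a , b) ∈ pairs (x ∷ ys) → b ∈ ys
  pair-target (y ∷ ys) (here refl) = here refl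
  pair-target (y ∷ ys) (there p) = there (pair-target ys p)

  next-unique : ∀ (xs : List A) {z a b c} → Unique xs →
                (a , b) ∈ pairs (xs ++ z ∷ []) → (a , c) ∈ pairs (xs ++ z ∷ []) → b ≡ c
  next-unique (x ∷ []) _ (here refl) (here refl) = refl
  next-unique (x ∷ y ∷ xs) _ (here refl) (here refl) = refl
  next-unique (x ∷ y ∷ xs) (x∉ ∷ _) (here refl) (there p) =
    contradiction refl (All.lookup x∉ (pair-source (y ∷ xs) p))
  next-unique (x ∷ y ∷ xs) (x∉ ∷ _) (there p) (here refl) =
    contradiction refl (All.lookup x∉ (pair-source (y ∷ xs) p))
  next-unique (x ∷ y ∷ xs) (_ ∷ u) (there p) (there p′) = next-unique (y ∷ xs) u p p′

  previous-unique : ∀ {x : A} ys {a b c} → Unique ys →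
                    (b , a) ∈ pairs (x ∷ ys) → (c , a) ∈ pairs (x ∷ ys) → b ≡ c
  previous-unique (y ∷ ys) _ (here refl) (here refl) = refl
  previous-unique (y ∷ ys) (y∉ ∷ _) (here refl) (there p) =
    contradiction refl (All.lookup y∉ (pair-target ys p))
  previous-unique (y ∷ ys) (y∉ ∷ _) (there p) (here refl) =
    contradiction refl (All.lookup y∉ (pair-target ys p))
  previous-unique (y ∷ ys) (_ ∷ u) (there p) (there p′) = previous-unique ys u p p′

  unique-init : ∀ (xs : List A) {ys} → Unique (xs ++ ys) → Unique xs
  unique-init [] _ = []
  unique-init (x ∷ xs) (x∉ ∷ u) = All.++⁻ˡ xs x∉ ∷ unique-init xs u

  pairs-unique : ∀ (xs : List A) {z} → Unique xs → Unique (pairs (xs ++ z ∷ []))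
  pairs-unique [] _ = []
  pairs-unique (x ∷ []) _ = [] ∷ []
  pairs-unique (x ∷ y ∷ xs) (x∉ ∷ u) =
    All.tabulate (λ { p refl → All.lookup x∉ (pair-source (y ∷ xs) p) refl })
    ∷ pairs-unique (y ∷ xs) u

  previous-pair : ∀ (x : A) {m u y} → u ∈ m → ∃ λ t → (t , u) ∈ pairs (x ∷ m ++ y ∷ [])
  previous-pair x (here refl) = x , here refl
  previous-pair x (there {v} p) with previous-pair v p
  ... | t , q = t , there q

  next-pair : ∀ (x : A) {m u y} → u ∈ m → ∃ λ t → (u , t) ∈ pairs (x ∷ m ++ y ∷ [])
  next-pair x {v ∷ []} (here refl) = _ , there (here refl)
  next-pair x {v ∷ w ∷ m} (here refl) = w , there (here refl)
  next-pair x (there {v} p) with next-pair v p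
  ... | t , q = t , there q

  unique-map⁺ : ∀ {B : Set} {f : A → B} {xs} → (∀ {u v} → u ∈ xs → v ∈ xs → f u ≡ f v → u ≡ v) →
                Unique xs → Unique (map f xs)
  unique-map⁺ {xs = []} _ _ = []
  unique-map⁺ {xs = x ∷ xs} inj (x∉ ∷ u) =
    All.map⁺ (All.tabulate λ p eq → All.lookup x∉ p (inj (here refl) (there p) eq))
    ∷ unique-map⁺ (λ p p′ → inj (there p) (there p′)) u

  unique-map-injective : ∀ {B : Set} {f : A → B} {xs u v} → Unique (map f xs) →
                         u ∈ xs → v ∈ xs → f u ≡ f v → u ≡ v
  unique-map-injective _ (here refl) (here refl) _ = refl
  unique-map-injective (x∉ ∷ _) (here refl) (there p) eq =
    contradiction eq (All.lookup (All.map⁻ x∉) p)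
  unique-map-injective (x∉ ∷ _) (there p) (here refl) eq =
    contradiction (sym eq) (All.lookup (All.map⁻ x∉) p)
  unique-map-injective (_ ∷ u) (there p) (there p′) eq = unique-map-injective u p p′ eq

  module _ {R : A → A → Set} where

    list-walk : ∀ x m {z} → (∀ {a b} → (a , b) ∈ pairs (x ∷ m ++ z ∷ []) → R a b) →
                Walk R (λ _ → ⊤) x z
    list-walk x [] r = step tt (r (here refl)) (stop tt)
    list-walk x (y ∷ m) r = step tt (r (here refl)) (list-walk y m (r ∘ there))

    list-walk-around : ∀ x m {z a b} → (∀ {a b} → (a , b) ∈ pairs (x ∷ m ++ z ∷ []) → R a b) →
                       (a , b) ∈ pairs (x ∷ m ++ z ∷ []) →
                       Walk R (λ _ → ⊤) x a × Walk R (λ _ → ⊤) b z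
    list-walk-around x [] r (here refl) = stop tt , stop tt
    list-walk-around x (y ∷ m) r (here refl) = stop tt , list-walk y m (r ∘ there)
    list-walk-around x (y ∷ m) r (there p) with list-walk-around y m (r ∘ there) p
    ... | v , w = step tt (r (here refl)) v , w

-- From digraphs to abstract cacti

module Walks (D : Digraph n) where

  pair-arc : ∀ {a b} l → IsWalk D l → (a , b) ∈ pairs l → Arc D a b
  pair-arc (x ∷ y ∷ l) (e , _) (here refl) = e
  pair-arc (x ∷ y ∷ l) (_ , w) (there p) = pair-arc (y ∷ l) w p

  from-list : ∀ {P : Fin n → Set} x m {y} → IsWalk D (seq x m y) → All P (seq x m y) →
              Walk (Arc D) P x y
  from-list x [] (e , _) (p ∷ p′ ∷ []) = step p e (stop p′)
  from-list x (z ∷ m) (e , w) (p ∷ ps) = step p e (from-list z m w ps)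

  simple-unique : ∀ {s t l} → SimplePath (Arc D) s t l → Unique l
  simple-unique end = [] ∷ []
  simple-unique (cons x∉ _ s) = All.map (_∘ sym) x∉ ∷ simple-unique s

  simple-closes : ∀ {s t l a} → SimplePath (Arc D) s t l → Arc D t a → IsWalk D (l ++ a ∷ [])
  simple-closes end e = e , tt
  simple-closes (cons _ f end) e = f , e , tt
  simple-closes (cons _ f s@(cons _ _ _)) e = f , simple-closes s e

  simple-starts : ∀ {s t l a b} → SimplePath (Arc D) s t l → (a , s) ∈ pairs (a ∷ l ++ b ∷ [])
  simple-starts end = here refl
  simple-starts (cons _ _ _) = here refl

  simple-ends : ∀ {s t l a} → SimplePath (Arc D) s t l → (t , a) ∈ pairs (l ++ a ∷ [])
  simple-ends end = here refl
  simple-ends (cons _ _ end) = there (here refl)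
  simple-ends (cons _ _ s@(cons _ _ _)) = there (simple-ends s)

  module _ {a s t l} (as : Arc D a s) (path : SimplePath (Arc D) s t l)
           (a∉l : All (_≢ a) l) (ta : Arc D t a) where
    open DecMembership (≡-dec (_≟_ {n}) (_≟_ {n})) using (_∈?_)

    cycle-through : Fin n → Fin n → Bool.Bool
    cycle-through u v = does ((u , v) ∈? pairs (a ∷ l ++ a ∷ []))

    private
      from-does : ∀ {P : Set} (d : Dec P) → does d ≡ true → P
      from-does (yes p) _ = p
      to-does : ∀ {P : Set} (d : Dec P) → P → does d ≡ true
      to-does (yes _) _ = refl
      to-does (no ¬p) p = contradiction p ¬p

    cycle-through-list : Unique (a ∷ l)
    cycle-through-list = All.map (_∘ sym) a∉l ∷ simple-unique path

    cycle-through-∈ : ∀ {u v} → cycle-through u v ≡ true → (u , v) ∈ pairs (a ∷ l ++ a ∷ [])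
    cycle-through-∈ = from-does (_ ∈? _)

    cycle-through-first : cycle-through a s ≡ true
    cycle-through-first = to-does (_ ∈? _) (simple-starts path)

    cycle-through-last : cycle-through t a ≡ true
    cycle-through-last = to-does (_ ∈? _) (last path (simple-ends path))
      where
      last : ∀ {x y l} → SimplePath (Arc D) x y l → ∀ {p} →
             p ∈ pairs (l ++ a ∷ []) → p ∈ pairs (a ∷ l ++ a ∷ [])
      last end = there
      last (cons _ _ _) = there

    cycle-through-cycle : IsDirCycle D cycle-through
    cycle-through-cycle = a , l , nonempty path , cycle-through-list , walk path as ,
      λ u v → from-does (_ ∈? _) , to-does (_ ∈? _)
      where
      nonempty : ∀ {x y l} → SimplePath (Arc D) x y l → l ≢ []
      nonempty end ()
      nonempty (cons _ _ _) ()
      walk : ∀ {x l} → SimplePath (Arc D) x t l → Arc D a x → IsWalk D (a ∷ l ++ a ∷ [])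
      walk s@end e = e , simple-closes s ta
      walk s@(cons _ _ _) e = e , simple-closes s ta

module FromDigraph (D : Digraph n) (isCactus : IsCactus D) (blocks : NumBlocks D q) where
  open Walks D

  private
    f = proj₁ blocks
    f-cycle = proj₁ (proj₂ blocks)
    f-distinct = proj₁ (proj₂ (proj₂ blocks))
    f-complete = proj₂ (proj₂ (proj₂ blocks))

    same : ∀ {C C′ : Fin n → Fin n → Bool.Bool} {u v} → IsDirCycle D C → IsDirCycle D C′ →
           Arc D u v → C u v ≡ true → C′ u v ≡ true → SameArcSet C C′
    same c c′ e p p′ a b with proj₂ (proj₂ isCactus) _ _ e
    ... | _ , _ , _ , unique = trans (unique _ c p a b) (sym (unique _ c′ p′ a b))

    Av : Fin n → Fin n → Fin n → Set
    Av = Avoiding (Arc D)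

    conn : ∀ x y → Walk (Arc D) (λ _ → ⊤) x y
    conn x y with x ≟ y
    ... | yes refl = stop tt
    ... | no x≢y with proj₁ (proj₂ isCactus) x y x≢y
    ...   | m , w , _ = from-list x m w (All.universal (λ _ → tt) _)

    in-cycle : ∀ i {a b} → f i a b ≡ true →
               (a , b) ∈ pairs (proj₁ (f-cycle i) ∷ proj₁ (proj₂ (f-cycle i)) ++ proj₁ (f-cycle i) ∷ [])
    in-cycle i {a} {b} p with f-cycle i
    ... | _ , _ , _ , _ , _ , iff = proj₁ (iff a b) p

    arc-of : ∀ i {a b} → f i a b ≡ true → Arc D a b
    arc-of i {a} {b} p with f-cycle i
    ... | v , l , _ , _ , w , iff = pair-arc (v ∷ l ++ v ∷ []) w (proj₁ (iff a b) p)

    closed-unique : ∀ {v : Fin n} {l} → Unique (v ∷ l) → Unique (l ++ v ∷ [])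
    closed-unique (v∉ ∷ u) = Unique.++⁺ u ([] ∷ [])
      λ { (p , here refl) → All.lookup v∉ p refl }

  -- Both walks close up, along the same path from y back to a, to cycles sharing an arc into a.
  diverge : ∀ {a b c y} → Arc D a b → Arc D a c → Av a b y → Av a c y → b ≡ c
  diverge {a} {b} {c} {y} ab ac v w with first-arrival (conn y a)
  ... | inj₁ refl = contradiction refl (walk-target v)
  ... | inj₂ (t , ta , u) with loop-erase (walk-++ v (walk-map id proj₂ u))
                             | loop-erase (walk-++ w (walk-map id proj₂ u))
  ...   | l , s , a∉l | l′ , s′ , a∉l′ =
    next-unique (a ∷ l) (cycle-through-list ab s a∉l ta) (simple-starts s)
      (cycle-through-∈ ab s a∉l ta
        (trans (same (cycle-through-cycle ab s a∉l ta) (cycle-through-cycle ac s′ a∉l′ ta) ta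
                     (cycle-through-last ab s a∉l ta) (cycle-through-last ac s′ a∉l′ ta) a c)
               (cycle-through-first ac s′ a∉l′ ta)))

  converge : ∀ {a b c y} → Arc D b a → Arc D c a → Av a y b → Av a y c → b ≡ c
  converge {a} {b} {c} {y} ba ca v w with last-exit (conn a y)
  ... | inj₁ refl = contradiction refl (walk-source v)
  ... | inj₂ (t , at , u) with loop-erase (walk-++ (walk-map id proj₂ u) v)
                             | loop-erase (walk-++ (walk-map id proj₂ u) w)
  ...   | l , s , a∉l | l′ , s′ , a∉l′ =
    previous-unique (l ++ a ∷ []) (closed-unique (cycle-through-list at s a∉l ba))
      (cycle-through-∈ at s a∉l ba (cycle-through-last at s a∉l ba))
      (cycle-through-∈ at s a∉l ba
        (trans (same (cycle-through-cycle at s a∉l ba) (cycle-through-cycle at s′ a∉l′ ca) at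
                     (cycle-through-first at s a∉l ba) (cycle-through-first at s′ a∉l′ ca) c a)
               (cycle-through-last at s′ a∉l′ ca)))

  cactus : Cactus n q
  cactus = record
    { E = Arc D
    ; E? = λ a b → adj D a b Bool.≟ true
    ; E-asym = λ {a} {b} ab ba → contradiction (trans (sym ba) (proj₂ (proj₁ isCactus) a b ab)) λ ()
    ; connected = conn
    ; out-unique = diverge
    ; in-unique = converge
    ; InC = λ i a b → f i a b ≡ true
    ; InC? = λ i a b → f i a b Bool.≟ true
    ; InC⇒E = λ {i} → arc-of i
    ; cycle-of = cycle-of
    ; cycle-unique = λ {i} {j} p p′ → f-distinct i j (same (f-cycle i) (f-cycle j) (arc-of i p) p p′)
    ; cycle-arc = cycle-arc
    ; cycle-out = λ {i} → cycle-out i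
    ; cycle-in = λ {i} → cycle-in i
    ; cycle-connected = λ {i} → cycle-connected i
    }
    where
    cycle-of : ∀ {a b} → Arc D a b → ∃ λ i → f i a b ≡ true
    cycle-of {a} {b} e with proj₂ (proj₂ isCactus) a b e
    ... | C , c , p , _ with f-complete C c
    ...   | i , eq = i , trans (sym (eq a b)) p
    cycle-arc : ∀ i → ∃₂ λ a b → f i a b ≡ true
    cycle-arc i with f-cycle i
    ... | v , [] , nonempty , _ = contradiction refl nonempty
    ... | v , x ∷ l , _ , _ , _ , iff = v , x , proj₂ (iff v x) (here refl)
    cycle-out : ∀ i {a b c} → f i a b ≡ true → f i a c ≡ true → b ≡ c
    cycle-out i p p′ =
      next-unique (_ ∷ _) (proj₁ (proj₂ (proj₂ (proj₂ (f-cycle i))))) (in-cycle i p) (in-cycle i p′)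
    cycle-in : ∀ i {a b c} → f i b a ≡ true → f i c a ≡ true → b ≡ c
    cycle-in i p p′ =
      previous-unique _ (closed-unique (proj₁ (proj₂ (proj₂ (proj₂ (f-cycle i))))))
                      (in-cycle i p) (in-cycle i p′)
    cycle-connected : ∀ i {a b c d} → f i a b ≡ true → f i c d ≡ true →
                      Walk (λ a b → f i a b ≡ true) (λ _ → ⊤) b c
    cycle-connected i {a} {b} {c} {d} p p′ with f-cycle i
    ... | v , l , _ , _ , _ , iff =
      walk-++ (proj₂ (list-walk-around v l (λ {a} {b} → proj₂ (iff a b)) (proj₁ (iff a b) p)))
              (proj₁ (list-walk-around v l (λ {a} {b} → proj₂ (iff a b)) (proj₁ (iff c d) p′)))

-- Clashes, palettes and cut-vertices in the digraph

module Interpretation (D : Digraph n) (isCactus : IsCactus D) (blocks : NumBlocks D q) where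
  open Walks D
  C : Cactus n q
  C = FromDigraph.cactus D isCactus blocks
  open Betweenness C hiding (arc; vertex)
  open Cuts C
  open Clashes C

  path-vertex : ∀ {u x y mid} → Sep u x y → u ≢ x → u ≢ y → IsWalk D (seq x mid y) → u ∈ mid
  path-vertex {u} {x} {y} {mid} s u≢x u≢y w with Any.any? (u ≟_) mid
  ... | yes p = p
  ... | no u∉mid = contradiction
    (from-list x mid w ((u≢x ∘ sym) ∷ All.∷ʳ⁺ (All.map (_∘ sym) (All.¬Any⇒All¬ mid u∉mid)) (u≢y ∘ sym))) s

  -- After a, the path goes on to y without returning to a, so by `out-unique` the arc that it takes
  -- there is a → b.
  path-arc : ∀ {a b x y} mid → E a b → Sep a x y → Av a b y →
             IsWalk D (seq x mid y) → Unique (seq x mid y) → (a , b) ∈ pairs (seq x mid y)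
  path-arc {a} {b} {x} {y} mid e s v w u with a ≟ x
  path-arc [] e s v (f , _) u | yes refl with out-unique e f v (stop (walk-target v))
  ... | refl = here refl
  path-arc (z ∷ mid) e s v (f , w) (x∉ ∷ _) | yes refl
    with out-unique e f v (from-list z mid w (All.map (_∘ sym) x∉))
  ... | refl = here refl
  path-arc [] e s v (f , _) u | no a≢x = contradiction (av-edge (a≢x ∘ sym) f (walk-target v)) s
  path-arc (z ∷ mid) e s v (f , w) (_ ∷ u) | no a≢x =
    there (path-arc mid e (λ v → s (step (a≢x ∘ sym) f v)) v w u)

  elements : Fin n → List (Fin n) → Fin n → List (Element n)
  elements x mid y = map vert mid ++ map (λ (a , b) → arrow a b) (pairs (seq x mid y))

  module _ {e f α β γ δ mid} (enter : Enters e α β) (leave : Leaves f γ δ)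
           (spans : Spans α β γ δ) (path : IsPath D α mid δ) where

    private
      α≢δ : α ≢ δ
      α≢δ = proj₁ spans
      α-off : Av α β γ
      α-off = proj₁ (proj₂ spans)
      δ-off : Av δ β γ
      δ-off = proj₂ (proj₂ spans)
      enters : ∀ {e} → Enters e α β → E α β
      enters (vert e) = e
      enters (arrow e) = e
      leaves : ∀ {f} → Leaves f γ δ → E γ δ
      leaves (vert e) = e
      leaves (arrow e) = e
      αβ = enters enter
      γδ = leaves leave

    entered-∈ : e ∈ elements α mid δ
    entered-∈ = go enter
      where
      go : ∀ {e} → Enters e α β → e ∈ elements α mid δ
      go (vert _) = ∈-++⁺ˡ (∈-map⁺ vert
        (path-vertex (sep-step αβ (walk-∷ʳ α-off γδ (α≢δ ∘ sym)))
                     (E⇒≢ αβ ∘ sym) (walk-source δ-off) (proj₁ path)))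
      go (arrow _) = ∈-++⁺ʳ (map vert mid) (∈-map⁺ _
        (path-arc mid αβ sep-left (walk-∷ʳ α-off γδ (α≢δ ∘ sym)) (proj₁ path) (proj₂ path)))

    left-∈ : f ∈ elements α mid δ
    left-∈ = go leave
      where
      before : Sep γ α δ
      before = sep-step′ γδ (step α≢δ αβ δ-off)
      go : ∀ {f} → Leaves f γ δ → f ∈ elements α mid δ
      go (vert _) = ∈-++⁺ˡ (∈-map⁺ vert
        (path-vertex before (walk-target α-off) (E⇒≢ γδ) (proj₁ path)))
      go (arrow _) = ∈-++⁺ʳ (map vert mid) (∈-map⁺ _
        (path-arc mid γδ before (stop (E⇒≢ γδ ∘ sym)) (proj₁ path) (proj₂ path)))

  rainbow-vertices : ∀ {k} ((col , _) : HasRVColouring D k) →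
                     ∀ {u v} → Clash (vert u) (vert v) → u ≢ v → col u ≢ col v
  rainbow-vertices (col , paths) = λ where
      (inj₁ p) u≢v eq → u≢v (same p eq)
      (inj₂ p) u≢v eq → u≢v (sym (same p (sym eq)))
    where
    inner : ∀ {u x y mid} → vert u ∈ elements x mid y → u ∈ mid
    inner {mid = mid} p with ∈-++⁻ (map vert mid) p
    ... | inj₁ p′ with ∈-map⁻ vert p′
    ...   | _ , r , refl = r
    inner {mid = mid} p | inj₂ p′ with ∈-map⁻ _ p′
    ...   | _ , _ , ()
    same : ∀ {u v} → Precedes (vert u) (vert v) → col u ≡ col v → u ≡ v
    same (α , _ , _ , δ , enter , leave , spans) eq with paths α δ (proj₁ spans)
    ... | mid , path , distinct =
      unique-map-injective distinct (inner (entered-∈ enter leave spans path))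
                                    (inner (left-∈ enter leave spans path)) eq

  colour : ∀ {k} → HasTRColouring D k → Element n → Fin k
  colour (cv , _ , _) (vert u) = cv u
  colour (_ , ca , _) (arrow a b) = ca a b

  rainbow-elements : ∀ {k} (tr : HasTRColouring D k) →
                     ∀ {e f} → Clash e f → e ≢ f → colour tr e ≢ colour tr f
  rainbow-elements tr@(cv , ca , paths) = λ where
      (inj₁ p) e≢f eq → e≢f (same p eq)
      (inj₂ p) e≢f eq → e≢f (sym (same p (sym eq)))
    where
    same : ∀ {e f} → Precedes e f → colour tr e ≡ colour tr f → e ≡ f
    same (α , _ , _ , δ , enter , leave , spans) eq with paths α δ (proj₁ spans)
    ... | mid , path , distinct =
      unique-map-injective (subst Unique (sym colours) distinct)
        (entered-∈ enter leave spans path) (left-∈ enter leave spans path) eq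
      where
      colours : map (colour tr) (elements α mid δ) ≡
                map cv mid ++ map (λ (a , b) → ca a b) (pairs (seq α mid δ))
      colours = trans (map-++ (colour tr) (map vert mid) _)
                      (cong₂ _++_ (sym (map-∘ mid)) (sym (map-∘ (pairs (seq α mid δ)))))

  module _ {r : Fin n} {t : ℕ} (K : Clique C r t) where
    open Counting K

    rv-bound : ∀ {k} → HasRVColouring D k → n + t ≤ k + (q + q)
    rv-bound c = vertex-bound (proj₁ c) (rainbow-vertices c)

    tr-bound : ∀ {k} → HasTRColouring D k → (n + n) + (t + 1) ≤ k + ((q + q) + q)
    tr-bound c = total-bound (colour c) (rainbow-elements c)

  module _ (far : Far) {r : Fin n} (cut-r : OutCut r) where

    private
      ro = proj₁ (proj₂ (proj₂ (proj₂ cut-r)))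
      ir = proj₁ (proj₂ (proj₂ (proj₂ (out-cut⇒in-cut cut-r))))
    open Twins C far cut-r ro ir

    private
      -- On the path, a successor of a cut-vertex can only be preceded by that cut-vertex, which
      -- occurs once and is followed by one vertex. The case of predecessors is dual.
      no-twins : ∀ {x y mid u v} → IsPath D x mid y → u ∈ mid → v ∈ mid → Twin u v → u ≡ v
      no-twins {x} {y} {mid} (walk , distinct) u∈ v∈ (w , cut-w , inj₁ (wu , wv))
        with previous-pair x {y = y} u∈ | previous-pair x {y = y} v∈
      ... | s , su | t , tv with single-entry cut-w wu (pair-arc _ walk su)
                               | single-entry cut-w wv (pair-arc _ walk tv)
      ...   | refl | refl = next-unique (x ∷ mid) (unique-init (x ∷ mid) distinct) su tv
      no-twins {x} {y} {mid} (walk , _ ∷ distinct) u∈ v∈ (w , cut-w , inj₂ (uw , vw))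
        with next-pair x {y = y} u∈ | next-pair x {y = y} v∈
      ... | s , us | t , vt with single-exit cut-w uw (pair-arc _ walk us)
                               | single-exit cut-w vw (pair-arc _ walk vt)
      ...   | refl | refl = previous-unique _ distinct us vt

      inner-unique : ∀ {x y mid} → IsPath D x mid y → Unique mid
      inner-unique {mid = mid} (_ , _ ∷ distinct) = unique-init mid distinct

      rainbow-inner : ∀ {x y mid} {A : Set} {col : Fin n → A} → IsPath D x mid y →
                      (∀ {u v} → col u ≡ col v → u ≢ v → Twin u v) → Unique (map col mid)
      rainbow-inner path twin = unique-map⁺ same (inner-unique path)
        where
        same : ∀ {u v} → u ∈ _ → v ∈ _ → _ → u ≡ v
        same {u} {v} u∈ v∈ eq with u ≟ v
        ... | yes u≡v = u≡v
        ... | no u≢v = no-twins path u∈ v∈ (twin eq u≢v)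

    -- Only an upper bound on m is known, hence the colouring is provided for every k ≥ m.
    rv-palette : ∃ λ m → m + (q + q) ≤ n + 2 × (∀ {k} → m ≤ k → HasRVColouring D k)
    rv-palette =
      let m , size , col , twin = vertex-palette
      in m , size , λ m≤k → (λ u → inject≤ (col u) m≤k) , λ x y x≢y →
        let mid , path = proj₁ (proj₂ isCactus) x y x≢y
        in mid , path , rainbow-inner path (twin ∘ inject≤-injective m≤k m≤k _ _)

    -- Vertices and arcs use disjoint palettes. The constant 3 is made up of o and i among the
    -- vertices and of the head o among the arcs.
    tr-palette : ∃ λ m → m + ((q + q) + q) ≤ (n + n) + 3 × (∀ {k} → m ≤ k → HasTRColouring D k)
    tr-palette = m + m′ , total-size , λ m≤k →
      (λ u → code m≤k (inj₁ (col u))) , (λ a b → code m≤k (inj₂ (col′ a b))) , λ x y x≢y →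
      let mid , path = proj₁ (proj₂ isCactus) x y x≢y
      in mid , path , rainbow m≤k path
      where
      m = proj₁ vertex-palette
      size = proj₁ (proj₂ vertex-palette)
      col = proj₁ (proj₂ (proj₂ vertex-palette))
      twin = proj₂ (proj₂ (proj₂ vertex-palette))
      m′ = proj₁ arc-palette
      size′ = proj₁ (proj₂ arc-palette)
      col′ = proj₁ (proj₂ (proj₂ arc-palette))
      twin′ = proj₂ (proj₂ (proj₂ arc-palette))
      total-size : (m + m′) + ((q + q) + q) ≤ (n + n) + 3
      total-size = begin
        (m + m′) + ((q + q) + q) ≡⟨ regroup m m′ (q + q) q ⟩
        (m + (q + q)) + (m′ + q) ≤⟨ ℕ.+-mono-≤ size size′ ⟩
        (n + 2) + (n + 1)        ≡⟨ regroup n 2 n 1 ⟩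
        (n + n) + 3              ∎
        where
        open ℕ.≤-Reasoning
        regroup : ∀ a b c d → (a + b) + (c + d) ≡ (a + c) + (b + d)
        regroup = solve 4 (λ a b c d → (a :+ b) :+ (c :+ d) := (a :+ c) :+ (b :+ d)) refl
          where
          open +-*-Solver
      code : ∀ {k} → m + m′ ≤ k → Fin m ⊎ Fin m′ → Fin k
      code m≤k x = inject≤ (join m m′ x) m≤k
      code-injective : ∀ {k} (m≤k : m + m′ ≤ k) {x y} → code m≤k x ≡ code m≤k y → x ≡ y
      code-injective m≤k eq =
        Injection.injective (↔⇒↣ (↔-sym +↔⊎)) (inject≤-injective m≤k m≤k _ _ eq)
      rainbow : ∀ {k x y mid} (m≤k : m + m′ ≤ k) → IsPath D x mid y →
        Unique (map (λ u → code m≤k (inj₁ (col u))) mid ++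
                map (λ p → code m≤k (inj₂ (col′ (proj₁ p) (proj₂ p)))) (pairs (seq x mid y)))
      rainbow {x = x} {y} {mid} m≤k path@(walk , distinct@(_ ∷ distinct′)) = Unique.++⁺
        (rainbow-inner path (twin ∘ inj₁-injective ∘ code-injective m≤k))
        (unique-map⁺ same (pairs-unique (x ∷ mid) (unique-init (x ∷ mid) distinct)))
        λ { (p , p′) → disjoint-colours (∈-map⁻ _ p) (∈-map⁻ _ p′) }
        where
        inj₁-injective : ∀ {a b} → inj₁ {B = Fin m′} a ≡ inj₁ b → a ≡ b
        inj₁-injective refl = refl
        inj₂-injective : ∀ {a b} → inj₂ {A = Fin m} a ≡ inj₂ b → a ≡ b
        inj₂-injective refl = refl
        same : ∀ {p p′} → p ∈ pairs (seq x mid y) → p′ ∈ pairs (seq x mid y) →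
               code m≤k (inj₂ (col′ (proj₁ p) (proj₂ p))) ≡
               code m≤k (inj₂ (col′ (proj₁ p′) (proj₂ p′))) → p ≡ p′
        same p∈ p′∈ eq with twin′ (pair-arc _ walk p∈) (pair-arc _ walk p′∈)
                                  (inj₂-injective (code-injective m≤k eq))
        ... | inj₁ refl =
          cong (_ ,_) (next-unique (x ∷ mid) (unique-init (x ∷ mid) distinct) p∈ p′∈)
        ... | inj₂ refl = cong (_, _) (previous-unique _ distinct′ p∈ p′∈)
        kinds-differ : ∀ {a b} → inj₁ {B = Fin m′} a ≢ inj₂ {A = Fin m} b
        kinds-differ ()
        disjoint-colours : ∀ {c} → (∃ λ u → u ∈ mid × c ≡ code m≤k (inj₁ (col u))) →
          (∃ λ p → p ∈ pairs (seq x mid y) ×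
                   c ≡ code m≤k (inj₂ (col′ (proj₁ p) (proj₂ p)))) → ⊥
        disjoint-colours (_ , _ , eq) (_ , _ , eq′) =
          kinds-differ (code-injective m≤k {inj₁ _} {inj₂ _} (trans (sym eq) eq′))

  out-cut⇒cut-vertex : ∀ {v} → OutCut v → IsCutVertex D v
  out-cut⇒cut-vertex {v} (a , b , a≢b , va , vb) =
    a , b , (E⇒≢ va ∘ sym) , (E⇒≢ vb ∘ sym) , λ { (mid , w , off) →
      a≢b (out-unique va vb (stay mid w off (stop (E⇒≢ va ∘ sym))) (stop (E⇒≢ vb ∘ sym))) }
    where
    -- Arcs missing v stay in the branch of v that starts with v → a.
    stay₁ : ∀ {x y} → E x y ⊎ E y x → y ≢ v → Av v a x → Av v a y
    stay₁ (inj₁ e) y≢v u = walk-∷ʳ u e y≢v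
    stay₁ (inj₂ e) y≢v u with succ (y≢v ∘ sym)
    ... | s , vs , w with out-unique va vs u (walk-∷ʳ w e (walk-target u))
    ...   | refl = w
    stay : ∀ {x y} mid → IsUWalk D (seq x mid y) → All (_≢ v) (seq x mid y) → Av v a x → Av v a y
    stay [] (e , _) (_ ∷ y≢v ∷ _) u = stay₁ e y≢v u
    stay (z ∷ mid) (e , w) (_ ∷ off@(z≢v ∷ _)) u = stay mid w off (stay₁ e z≢v u)

  -- If v has a single successor, every other vertex is reached from this successor without v, so
  -- the underlying graph stays connected when v is removed.
  cut-vertex⇒out-cut : ∀ {v} → IsCutVertex D v → OutCut v
  cut-vertex⇒out-cut {v} (x , y , x≢v , y≢v , separated) with out-cut? v
  ... | yes c = c
  ... | no ¬c = contradiction detour separated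
    where
    U : Fin n → Fin n → Set
    U a b = E a b ⊎ E b a
    joined : Walk U (_≢ v) x y
    joined with succ (x≢v ∘ sym) | succ (y≢v ∘ sym)
    ... | s , vs , w | s′ , vs′ , w′ with s ≟ s′
    ...   | yes refl = walk-++ (walk-map swap id (walk-reverse (walk-map inj₁ id w)))
                               (walk-map inj₁ id w′)
    ...   | no s≢s′ = contradiction (s , s′ , s≢s′ , vs , vs′) ¬c
    neighbour : ∃ λ z → z ≢ v × U x z
    neighbour with succ x≢v | pred (x≢v ∘ sym)
    ... | a , xa , _ | b , bx , _ with a ≟ v
    ...   | no a≢v = a , a≢v , inj₁ xa
    ...   | yes refl = b , (λ { refl → E-asym xa bx }) , inj₂ bx
    to-list : ∀ {a b c} → a ≢ v → U a b → Walk U (_≢ v) b c →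
              ∃ λ mid → IsUWalk D (seq a mid c) × All (_≢ v) (seq a mid c)
    to-list a≢v e (stop c≢v) = [] , (e , tt) , a≢v ∷ c≢v ∷ []
    to-list a≢v e (step b≢v f w) with to-list b≢v f w
    ... | mid , uw , off = _ ∷ mid , (e , uw) , a≢v ∷ off
    -- Going to a neighbour and back first, so that the walk is not empty when x ≡ y.
    detour : ∃ λ mid → IsUWalk D (seq x mid y) × All (_≢ v) (seq x mid y)
    detour with neighbour
    ... | z , z≢v , e = to-list x≢v e (step z≢v (swap e) joined)

  FarApart : Set
  FarApart = ∀ (u v : Fin n) → IsCutVertex D u → IsCutVertex D v → u ≢ v →
             ∀ k → Dist D u v k → 3 ≤ k

  far-apart⇒far : FarApart → Far
  far-apart⇒far apart {u} {v} cu cv u≢v = λ where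
      (inj₁ e) → no-arc e
      (inj₂ (x , ux , xv)) → contradiction
        (apart u v (out-cut⇒cut-vertex cu) (out-cut⇒cut-vertex cv) u≢v 2
          (((x ∷ []) , ((ux , xv , tt) ,
              ((E⇒≢ ux ∷ u≢v ∷ []) ∷ (E⇒≢ xv ∷ []) ∷ [] ∷ [])) , refl) , λ where
            [] ((e , _) , _) → contradiction e no-arc
            (_ ∷ mid) _ → s≤s (ℕ.m≤n+m 1 (length mid))))
        λ { (s≤s (s≤s ())) }
    where
    no-arc : ¬ E u v
    no-arc e = contradiction
      (apart u v (out-cut⇒cut-vertex cu) (out-cut⇒cut-vertex cv) u≢v 1
        (([] , ((e , tt) , ((u≢v ∷ []) ∷ [] ∷ [])) , refl) ,
          λ mid _ → ℕ.m≤n+m 1 (length mid)))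
      λ { (s≤s ()) }

  near-cuts : ∀ {u v k} → IsCutVertex D u → IsCutVertex D v → u ≢ v → Dist D u v k → ¬ 3 ≤ k →
              ∃ λ r → Clique C r 3
  near-cuts {u} {v} {k} cu cv u≢v ((mid , path , len) , _) k<3 =
    u , near-cuts-clique (cut-vertex⇒out-cut cu) (cut-vertex⇒out-cut cv) u≢v (short mid path len)
    where
    short : ∀ mid → IsPath D u mid v → length mid + 1 ≡ k → E u v ⊎ (∃ λ x → E u x × E x v)
    short [] ((e , _) , _) _ = inj₁ e
    short (x ∷ []) ((e , f , _) , _) _ = inj₂ (x , e , f)
    short (_ ∷ _ ∷ mid) _ refl = contradiction (s≤s (s≤s (ℕ.m≤n+m 1 (length mid)))) k<3

  far-apart : (¬ (∃ λ r → Clique C r 3)) → FarApart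
  far-apart no-clique u v cu cv u≢v k dist with 3 ≤? k
  ... | yes p = p
  ... | no k<3 = contradiction (near-cuts cu cv u≢v dist k<3) no-clique

-- Arithmetic of the bounds, and the equivalences

private
  -- Used with a = n, b = 2q, c = 2 for vertex-colourings and with a = 2n, b = 3q, c = 3 for
  -- total-colourings.
  module Bounds {a b c : ℕ} (b≤a : b ≤ a) where
    open ℕ.≤-Reasoning

    shift : ((a ∸ b) + c) + b ≡ a + c
    shift = trans (solve 3 (λ d c b → (d :+ c) :+ b := (d :+ b) :+ c) refl (a ∸ b) c b)
                  (cong (_+ c) (ℕ.m∸n+n≡m b≤a))
      where
      open +-*-Solver

    palette-≤ : ∀ {m} → m + b ≤ a + c → m ≤ (a ∸ b) + c
    palette-≤ {m} p = ℕ.+-cancelʳ-≤ b m _ (begin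
      m + b             ≤⟨ p ⟩
      a + c             ≡⟨ shift ⟨
      ((a ∸ b) + c) + b ∎)

    colours-≥ : ∀ {k} → a + c ≤ k + b → (a ∸ b) + c ≤ k
    colours-≥ {k} p = ℕ.+-cancelʳ-≤ b _ k (begin
      ((a ∸ b) + c) + b ≡⟨ shift ⟩
      a + c             ≤⟨ p ⟩
      k + b             ∎)

    colours-< : ¬ a + (c + 1) ≤ ((a ∸ b) + c) + b
    colours-< p = ℕ.<-irrefl refl (begin-strict
      a + c             <⟨ ℕ.+-monoʳ-< a (ℕ.m<m+n c (s≤s z≤n)) ⟩
      a + (c + 1)       ≤⟨ p ⟩
      ((a ∸ b) + c) + b ≡⟨ shift ⟩
      a + c             ∎)

theorem27 : ∀ {n q : ℕ} (Q : Digraph n) → IsCactus Q → NumBlocks Q q → 2 ≤ q →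
    (RVC≡ Q ((n ∸ 2 * q) + 2) ⇔ TRC≡ Q ((2 * n ∸ 3 * q) + 3)) ×
    (TRC≡ Q ((2 * n ∸ 3 * q) + 3) ⇔
    (∀ (u v : Fin n) → IsCutVertex Q u → IsCutVertex Q v → u ≢ v →
    ∀ k → Dist Q u v k → 3 ≤ k))
theorem27 {n} {q} Q isCactus blocks 2≤q =
  mk⇔ (apart⇒trc ∘ rvc⇒apart) (apart⇒rvc ∘ trc⇒apart) , mk⇔ trc⇒apart apart⇒trc
  where
  open Interpretation Q isCactus blocks
  open Cuts C
  cut : ∃ OutCut
  -- The hypothesis 2 ≤ q supplies two distinct cycle indices.
  cut = cut-exists {inject≤ zero 2≤q} {inject≤ (suc zero) 2≤q}
          λ eq → contradiction (inject≤-injective 2≤q 2≤q zero (suc zero) eq) λ ()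
  double : ∀ k → 2 * k ≡ k + k
  double k = cong (k +_) (ℕ.+-identityʳ k)
  triple : 3 * q ≡ (q + q) + q
  triple = trans (cong (q +_) (double q)) (sym (ℕ.+-assoc q q q))
  rv-size : (n ∸ 2 * q) + 2 ≡ (n ∸ (q + q)) + 2
  rv-size = cong (λ b → (n ∸ b) + 2) (double q)
  tr-size : (2 * n ∸ 3 * q) + 3 ≡ ((n + n) ∸ ((q + q) + q)) + 3
  tr-size = cong₂ (λ a b → (a ∸ b) + 3) (double n) triple
  2q≤n : q + q ≤ n
  2q≤n = Size.two-per-cycle C (proj₁ cut)
  3q≤2n : (q + q) + q ≤ n + n
  3q≤2n = ℕ.+-mono-≤ 2q≤n (ℕ.≤-trans (ℕ.m≤m+n q q) 2q≤n)
  apart⇒rvc : FarApart → RVC≡ Q ((n ∸ 2 * q) + 2)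
  apart⇒rvc apart =
    let _ , size , colouring = rv-palette (far-apart⇒far apart) (proj₂ cut)
    in subst (RVC≡ Q) (sym rv-size)
    ( colouring (Bounds.palette-≤ 2q≤n size)
    , λ _ col → Bounds.colours-≥ 2q≤n (rv-bound (cut-clique (proj₂ cut)) col))
  apart⇒trc : FarApart → TRC≡ Q ((2 * n ∸ 3 * q) + 3)
  apart⇒trc apart =
    let _ , size , colouring = tr-palette (far-apart⇒far apart) (proj₂ cut)
    in subst (TRC≡ Q) (sym tr-size)
    ( colouring (Bounds.palette-≤ 3q≤2n size)
    , λ _ col → Bounds.colours-≥ 3q≤2n (tr-bound (cut-clique (proj₂ cut)) col))
  rvc⇒apart : RVC≡ Q ((n ∸ 2 * q) + 2) → FarApart
  rvc⇒apart (col , _) = far-apart λ { (_ , K) →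
    Bounds.colours-< 2q≤n (rv-bound K (subst (HasRVColouring Q) rv-size col)) }
  trc⇒apart : TRC≡ Q ((2 * n ∸ 3 * q) + 3) → FarApart
  trc⇒apart (col , _) = far-apart λ { (_ , K) →
    Bounds.colours-< 3q≤2n (tr-bound K (subst (HasTRColouring Q) tr-size col)) }
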